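{- Let $q$ be an odd prime power, let $A\in M_2(\mathbb{F}_{q^2})$, and assume that $F_A$ is nonsingular. Furthermore, assume that there is at least one eigenvalue of $A$ in $\mathbb{F}_{q^2}$ with a corresponding eigenvector $\mathbf{u}$ such that $\langle\mathbf{u},\mathbf{u}\rangle\neq 0$. Let $z\in W(A)$ and let $S_z=\{\mathbf v\mid \langle A \mathbf v, \mathbf v\rangle=z,\ \langle\mathbf{v},\mathbf{v}\rangle=1\}$, i.e. the pre-image of the numerical range map at $z$. Let $\mathcal U=\{k+\beta \ell\in \mathbb{F}_{q^2}\mid k^2-\alpha \ell^2=1\}$, the set of unitary elements in $\mathbb{F}_{q^2}$. If $z \in \Gamma_F^\wedge$, then $|S_z/\mathcal U| = 1$. If $z\notin \Gamma_F^\wedge$ then $|S_z/\mathcal U|=2$. Equivalently, if $z \in \Gamma_F^\wedge$ then $|S_z| = q + 1$, and if $z \notin \Gamma_F^\wedge$ then $|S_z| = 2q + 2$.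
   Context: Setting: $q$ is an odd prime power, $\mathbb{F}_q$ the field with $q$ elements, $\alpha\in\mathbb{F}_q$ a non-square, and $\beta\in\mathbb{F}_{q^2}$ with $\beta^2=\alpha$, so $\mathbb{F}_{q^2}=\mathbb{F}_q[\beta]$. For $x\in\mathbb{F}_{q^2}$ write $\overline{x}=x^q$ and $|x|^2=x\overline{x}$. For a matrix $A$, $A^*$ is the transpose with $x\mapsto x^q$ applied to each entry; the Hermitian form on $\mathbb{F}_{q^2}^n$ is $\langle\mathbf u,\mathbf v\rangle=\mathbf v^*\mathbf u$. The numerical range is $W(A)=\{\langle A\mathbf v,\mathbf v\rangle : \langle\mathbf v,\mathbf v\rangle=1,\ \mathbf v\in\mathbb{F}_{q^2}^n\}$. Let $H_1=\mathrm{Re}\,A=(A+A^*)/2$ and $H_2=\mathrm{Im}\,A=(A-A^*)/(2\beta)$ (both Hermitian, $A=H_1+\beta H_2$). The base polynomial is $F_A(x:y:t)=\det(xH_1+yH_2+tI_n)$, a homogeneous polynomial with coefficients in $\mathbb{F}_q$; its zero set $\Gamma_F$ in $\mathbb{P}^2(\mathbb{F}_{q^2})$ is the base curve, and the dual curve $\Gamma_F^\wedge$ of $\Gamma_F$ is the boundary generating curve. Affine $\mathbb{F}_q$-points $(x,y)$ of $\Gamma_F^\wedge$ are identified with elements $x+\beta y\in\mathbb{F}_{q^2}$. -}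

module Defs where

open import Level using (0ℓ)
open import Data.Nat as ℕ using (ℕ; zero; suc)
open import Data.Nat.Primality using (Prime)
open import Data.Fin using (Fin; zero; suc)
open import Data.Fin.Properties using () renaming (_≟_ to _≟ᶠ_)
open import Data.Vec using (Vec; []; _∷_; lookup; map; tabulate)
open import Data.Product using (Σ; ∃; _×_; _,_)
open import Relation.Nullary using (¬_; yes; no)
open import Relation.Binary.PropositionalEquality using (_≡_)
open import Function.Bundles using (_↔_)
open import Algebra.Structures using (IsCommutativeRing)
open import Algebra.Core using (Op₁; Op₂)

OddPrimePower : ℕ → Set
OddPrimePower q = Σ ℕ λ p → Σ ℕ λ k → Prime p × ¬ (p ≡ 2) × q ≡ p ℕ.^ suc k

-- Fields (agda-stdlib has no field bundle): a commutative ring with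
-- propositional equality, 0 ≠ 1, and a (total) inverse function that is
-- a two-sided inverse on nonzero elements (its value at 0 is irrelevant).

record Field : Set₁ where
  infixl 7 _*_
  infixl 6 _+_
  field
    Carrier : Set
    _+_ _*_ : Op₂ Carrier
    -_      : Op₁ Carrier
    0# 1#   : Carrier
    isCommutativeRing : IsCommutativeRing _≡_ _+_ _*_ -_ 0# 1#
    inv     : Carrier → Carrier
    inv-r   : ∀ x → ¬ (x ≡ 0#) → x * inv x ≡ 1#
    0≢1     : ¬ (0# ≡ 1#)

-- Everything below is relative to a field L (playing F_{q^2}), the
-- number q (conjugation is x ↦ x^q) and β (with β² = α).

module Setup (L : Field) (q : ℕ) (β : Field.Carrier L) where
  open Field L

  C : Set
  C = Carrier

  infixl 6 _-_
  _-_ : C → C → C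
  x - y = x + (- y)

  pow : C → ℕ → C
  pow x zero    = 1#
  pow x (suc n) = x * pow x n

  conj : C → C
  conj x = pow x q

  InFq : C → Set
  InFq x = conj x ≡ x

  α : C
  α = β * β

  ∑ : ∀ {n} → (Fin n → C) → C
  ∑ {zero}  f = 0#
  ∑ {suc n} f = f zero + ∑ (λ i → f (suc i))

  Mat : ℕ → Set
  Mat n = Fin n → Fin n → C

  _·_ : ∀ {n} → Mat n → Vec C n → Vec C n
  _·_ {n} A v = tabulate λ i → ∑ λ j → A i j * lookup v j

  ⟨_,_⟩ : ∀ {n} → Vec C n → Vec C n → C
  ⟨ u , v ⟩ = ∑ λ i → conj (lookup v i) * lookup u i

  _* : ∀ {n} → Mat n → Mat n
  (A *) i j = conj (A j i)

  two : C
  two = 1# + 1#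

  ReM : ∀ {n} → Mat n → Mat n
  ReM A i j = (A i j + (A *) i j) * inv two

  ImM : ∀ {n} → Mat n → Mat n
  ImM A i j = (A i j - (A *) i j) * inv (two * β)

  idM : ∀ {n} → Mat n
  idM i j with i ≟ᶠ j
  ... | yes _ = 1#
  ... | no  _ = 0#

  W : ∀ {n} → Mat n → C → Set
  W {n} A z = ∃ λ (v : Vec C n) → ⟨ v , v ⟩ ≡ 1# × ⟨ A · v , v ⟩ ≡ z

  InS : ∀ {n} → Mat n → C → Vec C n → Set
  InS A z v = ⟨ A · v , v ⟩ ≡ z × ⟨ v , v ⟩ ≡ 1#

  -- Polynomials in the three variables x , y , t (indices 0 , 1 , 2),
  -- as syntax with evaluation and formal partial derivatives.

  data Poly : Set where
    var  : Fin 3 → Poly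
    con  : C → Poly
    _⊕_  : Poly → Poly → Poly
    _⊗_  : Poly → Poly → Poly
    ⊖_   : Poly → Poly

  eval : Vec C 3 → Poly → C
  eval p (var i) = lookup p i
  eval p (con c) = c
  eval p (f ⊕ g) = eval p f + eval p g
  eval p (f ⊗ g) = eval p f * eval p g
  eval p (⊖ f)   = - eval p f

  ∂ : Fin 3 → Poly → Poly
  ∂ i (var j) with i ≟ᶠ j
  ... | yes _ = con 1#
  ... | no  _ = con 0#
  ∂ i (con c) = con 0#
  ∂ i (f ⊕ g) = ∂ i f ⊕ ∂ i g
  ∂ i (f ⊗ g) = (∂ i f ⊗ g) ⊕ (f ⊗ ∂ i g)
  ∂ i (⊖ f)   = ⊖ ∂ i f

  -- base polynomial for n = 2:  F_A(x:y:t) = det (x H₁ + y H₂ + t I₂)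
  entry : Mat 2 → Fin 2 → Fin 2 → Poly
  entry A i j = ((var zero ⊗ con (ReM A i j)) ⊕ (var (suc zero) ⊗ con (ImM A i j)))
                ⊕ (var (suc (suc zero)) ⊗ con (idM i j))

  FA : Mat 2 → Poly
  FA A = (entry A zero zero ⊗ entry A (suc zero) (suc zero))
         ⊕ (⊖ (entry A zero (suc zero) ⊗ entry A (suc zero) zero))

  NonSingular : Mat 2 → Set
  NonSingular A = ∀ (p : Vec C 3) → eval p (FA A) ≡ 0#
                  → (∀ i → eval p (∂ i (FA A)) ≡ 0#) → ∀ i → lookup p i ≡ 0#

  -- z = u + βv (u , v ∈ F_q) is an affine F_q-point of the dual curve
  -- Γ_F^∧: the point (u : v : 1) is the tangent line u x + v y + t = 0 to
  -- Γ_F at some point p, i.e. ∇F_A(p) is a nonzero multiple of (u , v , 1).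
  InDual : Mat 2 → C → Set
  InDual A z = Σ C λ u → Σ C λ v → InFq u × InFq v × z ≡ u + β * v ×
               Σ (Vec C 3) λ p → eval p (FA A) ≡ 0# ×
               Σ C λ c → ¬ (c ≡ 0#) ×
                 eval p (∂ zero (FA A)) ≡ c * u ×
                 eval p (∂ (suc zero) (FA A)) ≡ c * v ×
                 eval p (∂ (suc (suc zero)) (FA A)) ≡ c

  GoodEigen : Mat 2 → Set
  GoodEigen A = Σ C λ λ₀ → Σ (Vec C 2) λ u → ¬ (∀ i → lookup u i ≡ 0#) ×
                (A · u ≡ map (λ₀ *_) u) × ¬ (⟨ u , u ⟩ ≡ 0#)

  InU : C → Set
  InU w = Σ C λ k → Σ C λ l → InFq k × InFq l × w ≡ k + β * l ×
          k * k - α * (l * l) ≡ 1#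

  _~U_ : ∀ {n} → Vec C n → Vec C n → Set
  v ~U w = Σ C λ u → InU u × w ≡ map (u *_) v

  CardS : Mat 2 → C → ℕ → Set
  CardS A z m = Fin m ↔ Σ (Vec C 2) (InS A z)

  CardOrbits : Mat 2 → C → ℕ → Set
  CardOrbits A z m = Σ (Vec (Vec C 2) m) λ r →
      (∀ i → InS A z (lookup r i)) ×
      (∀ i j → ¬ (i ≡ j) → ¬ (lookup r i ~U lookup r j)) ×
      (∀ v → InS A z v → Σ (Fin m) λ i → lookup r i ~U v)

{-# OPTIONS --safe #-}
module Submission where

-- Let u be the given eigenvector, with eigenvalue λ, and c = ⟨u,u⟩ ≠ 0. Together with its orthogonal
-- complement, of the same length c, u makes A upper triangular: in coordinates (a , b) one has
-- c ⟨v,v⟩ = |a|² + |b|² and c ⟨(A − λ)v , v⟩ = m ā b + δ |b|². Hence the fibre over z is cut out by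
-- |a|² + |b|² = c and m ā b + δ |b|² = ζ, where ζ = c (z − λ). Taking norms, s = |b|² is a root in F_q of
--   κ s² − (ζ δ̄ + ζ̄ δ + c |m|²) s + |ζ|² = 0,   κ = |δ|² + |m|²,
-- and surjectivity of the norm onto F_q shows that each root in F_q carries exactly one orbit of the
-- unitary group. Nonsingularity of F_A means |m|² ≠ 0 and κ ≠ 0; the quadratic has one root in F_q
-- because z ∈ W(A), hence two, and its discriminant is a nonzero multiple of the equation of the dual
-- conic at z. Finally the unitary group, a conic with a rational point, has q + 1 elements.

open import Defs
open import Level using (0ℓ)
open import Algebra.Bundles using (CommutativeMonoid; CommutativeRing)
open import Algebra.Solver.Ring.AlmostCommutativeRing
  using (AlmostCommutativeRing; fromCommutativeRing; _-Raw-AlmostCommutative⟶_)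
open import Data.Empty using (⊥; ⊥-elim)
open import Data.Fin using (Fin; zero; suc; toℕ; fromℕ; inject₁; punchOut; combine)
open import Data.Fin.Permutation using (↔⇒≡)
open import Data.Integer as ℤ using (ℤ; -[1+_])
open import Data.Maybe using (Maybe; just; nothing)
open import Data.Nat as ℕ using (ℕ; zero; suc; _!; _∸_)
open import Data.Nat.Combinatorics using (nCn≡1; nCk≡n!/k![n-k]!; k![n∸k]!∣n!) renaming (_C_ to _choose_)
open import Data.Nat.Divisibility using (_∣_; divides; ∣1⇒≡1; ∣⇒≤; m%n≡0⇒n∣m; m∣m*n)
open import Data.Nat.DivMod using (_%_; _/_; m≡m%n+[m/n]*n; m/n*n≡m; m%n<n)
open import Data.Nat.Primality using (Prime; prime⇒irreducible; prime⇒nonTrivial; euclidsLemma)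
open import Data.Nat.Tactic.RingSolver using (solve-∀)
open import Data.Product using (Σ; ∃; ∃₂; _×_; _,_; proj₁; proj₂)
open import Data.Product.Function.NonDependent.Propositional using (_×-↔_)
open import Data.Sum using (_⊎_; inj₁; inj₂; [_,_]′)
open import Data.Sum.Function.Propositional using (_⊎-↔_)
open import Data.Vec using (Vec; []; _∷_; lookup; map; head; tail)
open import Function using (_∘_)
open import Function.Bundles using (_↔_; Inverse; Injection; mk↔ₛ′)
open import Function.Construct.Composition using (_↔-∘_)
open import Function.Construct.Symmetry using (↔-sym)
open import Function.Properties.Inverse using (↔-refl; ↔⇒↣)
open import Relation.Binary.Definitions using (DecidableEquality; tri<; tri≈; tri>)
open import Relation.Binary.PropositionalEquality
open import Relation.Binary.PropositionalEquality.WithK using (≡-irrelevant)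
open import Relation.Nullary using (¬_; Dec; yes; no; contradiction)
open import Relation.Nullary.Decidable using (map′; via-injection; decidable-stable)
open import Relation.Unary using (Decidable; Irrelevant)
import Algebra.Properties.AbelianGroup
import Algebra.Properties.CommutativeMonoid.Sum
import Algebra.Properties.CommutativeSemiring.Binomial
import Algebra.Properties.CommutativeSemiring.Exp
import Algebra.Properties.Ring
import Algebra.Properties.Semiring.Mult
import Algebra.Properties.Semiring.Mult.TCOptimised
import Algebra.Solver.Ring
import Data.Fin.Properties as Fin
import Data.Integer.Properties as ℤ
import Data.Nat.Properties as ℕ

-- Since A - λ kills u, it is w (u₂ , - u₁) for a single vector w, so (A - λ)v = b w with b = u₂ x -
-- u₁ y. The constants m and δ are the coordinates of w itself: m = ⟨w,u⟩, while δ is also the trace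
-- of A - λ. Keeping the factor c throughout avoids choosing a scalar of norm c to normalise u. The
-- same rank one form simplifies F_A: in suitable coordinates it is τ² + τ(sδ + s′δ̄) - N s s′ with
-- N = |m|², whose matrix of second derivatives has determinant - 2Nκ. This is where the two
-- conditions N ≠ 0 and κ ≠ 0 come from. A root s fixes |b|² = s and |a|² = c - s, and, as m ≠ 0,
-- also ā b; such a pair (a , b) is determined up to a unitary scalar. The field L is abstract: it
-- is known only to have q² elements, and conjugation is only a power. That conjugation is an
-- additive involution, that its fixed field has q elements and that the norm is onto are all
-- derived from the enumeration, by counting rather than from a generator of the multiplicative
-- group.

-- Field arithmetic and a ring solver with integer coefficients.

module FieldProperties (L : Field) where
  open Field L public

  commutativeRing : CommutativeRing 0ℓ 0ℓ
  commutativeRing = record { isCommutativeRing = isCommutativeRing }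

  open CommutativeRing commutativeRing public
    using (ring; semiring; +-assoc; +-comm; *-assoc; *-comm; +-identityˡ; +-identityʳ
          ; *-identityˡ; *-identityʳ; zeroˡ; zeroʳ; -‿inverseˡ; -‿inverseʳ
          ; +-abelianGroup; +-commutativeMonoid; *-commutativeMonoid
          ; commutativeSemiring)

  private
    module R  = Algebra.Properties.Ring ring
    module G  = Algebra.Properties.AbelianGroup +-abelianGroup
    -- In this variant the multiple by 1 reduces to the element itself, so `1-homo` is `refl` and
    -- `:2` denotes 1# + 1#, which is `two`.
    open Algebra.Properties.Semiring.Mult.TCOptimised semiring
      using (1+×; ×-homo-+; ×1-homo-*) renaming (_×_ to _×ₙ_)

    -- Integers have decidable equality, which a bare `Field` does not provide; with them as
    -- coefficients the solver can cancel terms in any characteristic.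
    fromℤ : ℤ → Carrier
    fromℤ (ℤ.+ n)    = n ×ₙ 1#
    fromℤ -[1+ n ] = - (suc n ×ₙ 1#)

    fromℤ-neg : ∀ i → fromℤ (ℤ.- i) ≡ - fromℤ i
    fromℤ-neg (ℤ.+ zero)   = sym R.-0#≈0#
    fromℤ-neg (ℤ.+ suc n)  = refl
    fromℤ-neg (-[1+ n ]) = sym (R.-‿involutive _)

    fromℤ-⊖ : ∀ m n → fromℤ (m ℤ.⊖ n) ≡ m ×ₙ 1# + (- (n ×ₙ 1#))
    fromℤ-⊖ m zero = begin
      m ×ₙ 1#               ≡⟨ +-identityʳ _ ⟨
      m ×ₙ 1# + 0#          ≡⟨ cong (m ×ₙ 1# +_) R.-0#≈0# ⟨
      m ×ₙ 1# + (- 0#)      ∎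
      where open ≡-Reasoning
    fromℤ-⊖ zero (suc n) = sym (+-identityˡ _)
    fromℤ-⊖ (suc m) (suc n) = begin
      fromℤ (suc m ℤ.⊖ suc n)                  ≡⟨ cong fromℤ (ℤ.[1+m]⊖[1+n]≡m⊖n m n) ⟩
      fromℤ (m ℤ.⊖ n)                          ≡⟨ fromℤ-⊖ m n ⟩
      a + (- b)                                ≡⟨ cong (_+ (- b)) (G.xyx⁻¹≈y 1# a) ⟨
      (1# + a + (- 1#)) + (- b)                ≡⟨ +-assoc _ _ _ ⟩
      (1# + a) + ((- 1#) + (- b))              ≡⟨ cong (1# + a +_) (G.⁻¹-∙-comm 1# b) ⟩
      (1# + a) + (- (1# + b))                  ≡⟨ cong₂ (λ x y → x + (- y)) (1+× m 1#) (1+× n 1#) ⟨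
      suc m ×ₙ 1# + (- (suc n ×ₙ 1#))            ∎
      where
      open ≡-Reasoning
      a = m ×ₙ 1#
      b = n ×ₙ 1#

    fromℤ-+ : ∀ i j → fromℤ (i ℤ.+ j) ≡ fromℤ i + fromℤ j
    fromℤ-+ (ℤ.+ m)    (ℤ.+ n)    = ×-homo-+ 1# m n
    fromℤ-+ (ℤ.+ m)    -[1+ n ] = fromℤ-⊖ m (suc n)
    fromℤ-+ -[1+ m ] (ℤ.+ n)    = trans (fromℤ-⊖ n (suc m)) (+-comm _ _)
    fromℤ-+ -[1+ m ] -[1+ n ] = begin
      - (suc (suc (m ℕ.+ n)) ×ₙ 1#)             ≡⟨ cong (λ k → - (k ×ₙ 1#)) (cong suc (ℕ.+-suc m n)) ⟨
      - ((suc m ℕ.+ suc n) ×ₙ 1#)               ≡⟨ cong -_ (×-homo-+ 1# (suc m) (suc n)) ⟩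
      - (suc m ×ₙ 1# + suc n ×ₙ 1#)              ≡⟨ G.⁻¹-∙-comm _ _ ⟨
      (- (suc m ×ₙ 1#)) + (- (suc n ×ₙ 1#))      ∎
      where open ≡-Reasoning

    fromℤ-pos* : ∀ m j → fromℤ (ℤ.+ m ℤ.* j) ≡ fromℤ (ℤ.+ m) * fromℤ j
    fromℤ-pos* m (ℤ.+ n) = trans (cong fromℤ (sym (ℤ.pos-* m n))) (×1-homo-* m n)
    fromℤ-pos* m -[1+ n ] = begin
      fromℤ (ℤ.+ m ℤ.* -[1+ n ])                 ≡⟨ cong fromℤ (ℤ.neg-distribʳ-* (ℤ.+ m) (ℤ.+ suc n)) ⟨
      fromℤ (ℤ.- (ℤ.+ m ℤ.* ℤ.+ suc n))            ≡⟨ fromℤ-neg (ℤ.+ m ℤ.* ℤ.+ suc n) ⟩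
      - fromℤ (ℤ.+ m ℤ.* ℤ.+ suc n)                ≡⟨ cong -_ (fromℤ-pos* m (ℤ.+ suc n)) ⟩
      - (fromℤ (ℤ.+ m) * fromℤ (ℤ.+ suc n))        ≡⟨ R.-‿distribʳ-* _ _ ⟩
      fromℤ (ℤ.+ m) * fromℤ -[1+ n ]             ∎
      where open ≡-Reasoning

    fromℤ-* : ∀ i j → fromℤ (i ℤ.* j) ≡ fromℤ i * fromℤ j
    fromℤ-* (ℤ.+ m)    j = fromℤ-pos* m j
    fromℤ-* -[1+ m ] j = begin
      fromℤ (-[1+ m ] ℤ.* j)                   ≡⟨ cong fromℤ (ℤ.neg-distribˡ-* (ℤ.+ suc m) j) ⟨
      fromℤ (ℤ.- (ℤ.+ suc m ℤ.* j))              ≡⟨ fromℤ-neg (ℤ.+ suc m ℤ.* j) ⟩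
      - fromℤ (ℤ.+ suc m ℤ.* j)                  ≡⟨ cong -_ (fromℤ-pos* (suc m) j) ⟩
      - (fromℤ (ℤ.+ suc m) * fromℤ j)            ≡⟨ R.-‿distribˡ-* _ _ ⟩
      fromℤ -[1+ m ] * fromℤ j                 ∎
      where open ≡-Reasoning

    almostRing : AlmostCommutativeRing 0ℓ 0ℓ
    almostRing = fromCommutativeRing commutativeRing

    ℤ-morphism : ℤ.+-*-rawRing -Raw-AlmostCommutative⟶ almostRing
    ℤ-morphism = record
      { ⟦_⟧    = fromℤ
      ; +-homo = fromℤ-+
      ; *-homo = fromℤ-*
      ; -‿homo = fromℤ-neg
      ; 0-homo = refl
      ; 1-homo = refl
      }

    coefficients≟ : (i j : ℤ) → Maybe (fromℤ i ≡ fromℤ j)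
    coefficients≟ i j with i ℤ.≟ j
    ... | yes i≡j = just (cong fromℤ i≡j)
    ... | no _    = nothing

  module Solver = Algebra.Solver.Ring ℤ.+-*-rawRing almostRing ℤ-morphism coefficients≟
  open Solver public using (Polynomial; solve; _:=_; _:+_; _:*_; _:-_; :-_; con)

  +-cancelʳ : ∀ {x y} z → x + z ≡ y + z → x ≡ y
  +-cancelʳ z = R.+-cancelʳ z _ _

  -- Deduces l ≡ r from hypotheses aᵢ ≡ bᵢ and the ring identity l − r = Σ kᵢ (aᵢ − bᵢ),
  -- stated free of subtraction.
  modulo₁ : ∀ {a b l r} k → a ≡ b → l + k * b ≡ r + k * a → l ≡ r
  modulo₁ k refl e = +-cancelʳ _ e

  modulo₂ : ∀ {a b a′ b′ l r} k → a ≡ b → ∀ k′ → a′ ≡ b′ →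
            l + k * b + k′ * b′ ≡ r + k * a + k′ * a′ → l ≡ r
  modulo₂ k p k′ p′ e = modulo₁ k p (modulo₁ k′ p′ e)

  modulo₃ : ∀ {a b a′ b′ a″ b″ l r} k → a ≡ b → ∀ k′ → a′ ≡ b′ → ∀ k″ → a″ ≡ b″ →
            l + k * b + k′ * b′ + k″ * b″ ≡ r + k * a + k′ * a′ + k″ * a″ → l ≡ r
  modulo₃ k p k′ p′ k″ p″ e = modulo₂ k p k′ p′ (modulo₁ k″ p″ e)

  :0 : ∀ {n} → Polynomial n
  :0 = con (ℤ.+ 0)

  :1 : ∀ {n} → Polynomial n
  :1 = con (ℤ.+ 1)

  :2 : ∀ {n} → Polynomial n
  :2 = con (ℤ.+ 2)

  inv-l : ∀ x → x ≢ 0# → inv x * x ≡ 1#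
  inv-l x x≢0 = trans (*-comm _ _) (inv-r x x≢0)

  *-cancelˡ : ∀ {x} y z → x ≢ 0# → x * y ≡ x * z → y ≡ z
  *-cancelˡ {x} y z x≢0 e = modulo₂ (y + (- z)) (sym (inv-r x x≢0)) (inv x) e
    (solve 4 (λ x y z i → y :+ (y :- z) :* (x :* i) :+ i :* (x :* z)
                       := z :+ (y :- z) :* :1 :+ i :* (x :* y)) refl x y z (inv x))

  *≡0⇒ : ∀ {x y} → x ≢ 0# → x * y ≡ 0# → y ≡ 0#
  *≡0⇒ x≢0 e = *-cancelˡ _ _ x≢0 (trans e (sym (zeroʳ _)))

  *-≢0 : ∀ {x y} → x ≢ 0# → y ≢ 0# → x * y ≢ 0#
  *-≢0 x≢0 y≢0 e = y≢0 (*≡0⇒ x≢0 e)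

-- Divisibility of binomial coefficients by a prime.

prime∣! : ∀ {p} → Prime p → ∀ m → p ∣ m ! → p ℕ.≤ m
prime∣! {p} pp zero    p∣1 = contradiction (∣1⇒≡1 p∣1) (ℕ.nonTrivial⇒≢1 {{prime⇒nonTrivial pp}})
prime∣! {p} pp (suc m) p∣m! with euclidsLemma (suc m) (m !) pp p∣m!
... | inj₁ p∣1+m = ∣⇒≤ p∣1+m
... | inj₂ p∣m!′ = ℕ.m≤n⇒m≤1+n (prime∣! pp m p∣m!′)

-- The prime p divides p! = C(p , k) · k! (p - k)!, but neither of the two factorials, whose
-- arguments are below p.
prime∣C : ∀ {p} → Prime p → ∀ {k} → 0 ℕ.< k → k ℕ.< p → p ∣ p choose k
prime∣C {p@(suc p-1)} pp {k} 0<k k<p with euclidsLemma (p choose k) (k ! ℕ.* (p ∸ k) !) pp p∣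
  where
  k≤p = ℕ.<⇒≤ k<p
  instance _ = k ℕ.!* (p ∸ k) !≢0
  p∣ : p ∣ (p choose k) ℕ.* (k ! ℕ.* (p ∸ k) !)
  p∣ = subst (p ∣_) (sym (trans (cong (ℕ._* (k ! ℕ.* (p ∸ k) !)) (nCk≡n!/k![n-k]! k≤p))
                                (m/n*n≡m (k![n∸k]!∣n! k≤p))))
             (m∣m*n (p-1 !))
... | inj₁ p∣C = p∣C
... | inj₂ p∣d with euclidsLemma (k !) ((p ∸ k) !) pp p∣d
...   | inj₁ p∣k! = contradiction (prime∣! pp k p∣k!) (ℕ.<⇒≱ k<p)
...   | inj₂ p∣! = contradiction (prime∣! pp (p ∸ k) p∣!)
                     (ℕ.<⇒≱ (ℕ.∸-monoʳ-< 0<k (ℕ.<⇒≤ k<p)))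
  
oddPrime : ∀ {p} → Prime p → p ≢ 2 → ∃ λ j → p ≡ 1 ℕ.+ j ℕ.* 2
oddPrime {p} pp p≢2 with p % 2 in eq | m%n<n p 2 | m≡m%n+[m/n]*n p 2
... | 0 | _ | _ with prime⇒irreducible pp (m%n≡0⇒n∣m p 2 eq)
...   | inj₁ ()
...   | inj₂ 2≡p = contradiction (sym 2≡p) p≢2
oddPrime {p} pp p≢2 | 1 | _ | e = p / 2 , e
oddPrime {p} pp p≢2 | suc (suc _) | ℕ.s≤s (ℕ.s≤s ()) | _

-- Sums over an enumerated type, used both additively and multiplicatively.

module FiniteSums (M : CommutativeMonoid 0ℓ 0ℓ) {A : Set} {n} (enum : Fin n ↔ A) where
  open CommutativeMonoid M hiding (refl; sym; trans)
  private module ≈ = CommutativeMonoid M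
  open Algebra.Properties.CommutativeMonoid.Sum M
  open Inverse enum using (to)

  total : (A → Carrier) → Carrier
  total f = sum (f ∘ to)

  total-cong : ∀ {f g : A → Carrier} → (∀ x → f x ≈ g x) → total f ≈ total g
  total-cong f≈g = sum-cong-≋ (f≈g ∘ to)

  total-∙ : ∀ (f g : A → Carrier) → total (λ x → f x ∙ g x) ≈ total f ∙ total g
  total-∙ f g = ∑-distrib-+ (f ∘ to) (g ∘ to)

  total-reindex : ∀ (f : A → Carrier) (π : A ↔ A) → total f ≈ total (f ∘ Inverse.to π)
  total-reindex f π = ≈.trans (sum-permute (f ∘ to) (↔-sym enum ↔-∘ (π ↔-∘ enum)))
    (sum-cong-≋ λ i → reflexive (cong f (Inverse.strictlyInverseˡ enum (Inverse.to π (to i)))))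

  sum-single : ∀ {m} (g : Fin m → Carrier) i → (∀ j → j ≢ i → g j ≈ ε) → sum g ≈ g i
  sum-single {suc m} g zero e = ≈.trans (∙-congˡ (≈.trans (sum-cong-≋ (λ j → e (suc j) λ ()))
      (sum-replicate-zero m))) (identityʳ _)
  sum-single {suc m} g (suc i) e = ≈.trans (∙-cong (e zero λ ())
      (sum-single (g ∘ suc) i λ j j≢i → e (suc j) (j≢i ∘ Fin.suc-injective))) (identityˡ _)

  total-single : ∀ (f : A → Carrier) a → (∀ x → x ≢ a → f x ≈ ε) → total f ≈ f a
  total-single f a e = ≈.trans (sum-single (f ∘ to) (Inverse.from enum a)
      λ j j≢ → e (to j) λ toj≡a → j≢ (trans (sym (Inverse.strictlyInverseʳ enum j))
          (cong (Inverse.from enum) toj≡a)))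
    (reflexive (cong f (Inverse.strictlyInverseˡ enum a)))

-- Finite fields: the identity xⁿ = x, the characteristic and the Frobenius map.

module FiniteFieldProperties (L : Field) {n} (enum : Fin n ↔ Field.Carrier L) where
  open FieldProperties L
  open Algebra.Properties.Semiring.Mult semiring using (×-homo-+; ×1-homo-*; ×-assoc-*) renaming (_×_ to _·_)
  open Algebra.Properties.CommutativeSemiring.Exp commutativeSemiring using (_^_; ^-assocʳ; ^-distrib-*)

  _≟_ : DecidableEquality Carrier
  _≟_ = via-injection (↔⇒↣ (↔-sym enum)) Fin._≟_

  module S = FiniteSums +-commutativeMonoid enum
  module P = FiniteSums *-commutativeMonoid enum

  sum-const : ∀ x → S.total (λ _ → x) ≡ n · x
  sum-const x = Algebra.Properties.CommutativeMonoid.Sum.sum-replicate +-commutativeMonoid n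

  prod-const : ∀ x → P.total (λ _ → x) ≡ x ^ n
  prod-const x = Algebra.Properties.CommutativeMonoid.Sum.sum-replicate *-commutativeMonoid n

  -- Translation by 1 permutes the field, so adding 1 to each of the n elements leaves their sum
  -- unchanged.
  card·1≡0 : n · 1# ≡ 0#
  card·1≡0 = +-cancelʳ (S.total (λ y → y)) (begin
    n · 1# + S.total (λ y → y)            ≡⟨ cong (_+ S.total (λ y → y)) (sum-const 1#) ⟨
    S.total (λ _ → 1#) + S.total (λ y → y) ≡⟨ S.total-∙ (λ _ → 1#) (λ y → y) ⟨
    S.total (λ y → 1# + y)                ≡⟨ S.total-reindex (λ y → y) translation ⟨
    S.total (λ y → y)                     ≡⟨ +-identityˡ _ ⟨
    0# + S.total (λ y → y)                ∎)
    where
    open ≡-Reasoning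
    translation : Carrier ↔ Carrier
    translation = mk↔ₛ′ (1# +_) ((- 1#) +_)
      (λ y → solve 1 (λ y → :1 :+ ((:- :1) :+ y) := y) refl y)
      (λ y → solve 1 (λ y → (:- :1) :+ (:1 :+ y) := y) refl y)

  -- Replacing 0 by 1 lets the product of the nonzero elements be taken over the whole enumeration.
  nonzeroPart : Carrier → Carrier
  nonzeroPart y with y ≟ 0#
  ... | yes _ = 1#
  ... | no  _ = y

  nonzeroPart≢0 : ∀ y → nonzeroPart y ≢ 0#
  nonzeroPart≢0 y with y ≟ 0#
  ... | yes _  = 0≢1 ∘ sym
  ... | no y≢0 = y≢0

  product≢0 : ∀ {m} (f : Fin m → Carrier) → (∀ i → f i ≢ 0#) →
              Algebra.Properties.CommutativeMonoid.Sum.sum *-commutativeMonoid f ≢ 0#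
  product≢0 {zero}  f f≢0 = 0≢1 ∘ sym
  product≢0 {suc m} f f≢0 = *-≢0 (f≢0 zero) (product≢0 (f ∘ suc) (f≢0 ∘ suc))

  -- Multiplication by x permutes the nonzero elements; y = 0 contributes the stray factor.
  ^-card : ∀ x → x ^ n ≡ x
  ^-card x with x ≟ 0#
  ... | yes refl = 0^ enum
    where
    0^ : ∀ {m} → Fin m ↔ Carrier → 0# ^ m ≡ 0#
    0^ {zero}  e with () ← Inverse.from e 0#
    0^ {suc m} e = zeroˡ _
  ... | no x≢0 = *-cancelˡ _ _ (product≢0 _ (nonzeroPart≢0 ∘ Inverse.to enum)) (begin
    T * x ^ n                                      ≡⟨ *-comm _ _ ⟩
    x ^ n * T                                      ≡⟨ cong (_* T) (prod-const x) ⟨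
    P.total (λ _ → x) * T                          ≡⟨ P.total-∙ (λ _ → x) nonzeroPart ⟨
    P.total (λ y → x * nonzeroPart y)              ≡⟨ P.total-cong stray ⟩
    P.total (λ y → h y * nonzeroPart (x * y))      ≡⟨ P.total-∙ h (λ y → nonzeroPart (x * y)) ⟩
    P.total h * P.total (λ y → nonzeroPart (x * y)) ≡⟨ cong₂ _*_ total-h
        (sym (P.total-reindex nonzeroPart scaling)) ⟩
    x * T                                          ≡⟨ *-comm _ _ ⟩
    T * x                                          ∎)
    where
    open ≡-Reasoning
    T = P.total nonzeroPart

    scaling : Carrier ↔ Carrier
    scaling = mk↔ₛ′ (x *_) (inv x *_)
      (λ y → trans (sym (*-assoc _ _ _)) (trans (cong (_* y) (inv-r x x≢0)) (*-identityˡ y)))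
      (λ y → trans (sym (*-assoc _ _ _)) (trans (cong (_* y) (inv-l x x≢0)) (*-identityˡ y)))

    h : Carrier → Carrier
    h y with y ≟ 0#
    ... | yes _ = x
    ... | no  _ = 1#

    h≡1 : ∀ y → y ≢ 0# → h y ≡ 1#
    h≡1 y y≢0 with y ≟ 0#
    ... | yes y≡0 = contradiction y≡0 y≢0
    ... | no _    = refl

    h0≡x : h 0# ≡ x
    h0≡x with 0# ≟ 0#
    ... | yes _  = refl
    ... | no 0≢0 = contradiction refl 0≢0

    total-h : P.total h ≡ x
    total-h = trans (P.total-single h 0# h≡1) h0≡x

    stray : ∀ y → x * nonzeroPart y ≡ h y * nonzeroPart (x * y)
    stray y with y ≟ 0# | (x * y) ≟ 0#
    ... | yes _    | yes _   = refl
    ... | yes refl | no x0≢0 = contradiction (zeroʳ x) x0≢0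
    ... | no y≢0   | yes e   = contradiction e (*-≢0 x≢0 y≢0)
    ... | no _     | no _    = sym (*-identityˡ _)

  ·-vanish : ∀ p → p · 1# ≡ 0# → ∀ {k} → p ∣ k → ∀ z → k · z ≡ 0#
  ·-vanish p p1≡0 (divides m refl) z = begin
    (m ℕ.* p) · z        ≡⟨ cong ((m ℕ.* p) ·_) (*-identityˡ z) ⟨
    (m ℕ.* p) · (1# * z) ≡⟨ ×-assoc-* (m ℕ.* p) 1# z ⟨
    ((m ℕ.* p) · 1#) * z ≡⟨ cong (_* z) (×1-homo-* m p) ⟩
    (m · 1# * p · 1#) * z ≡⟨ cong (λ t → (m · 1# * t) * z) p1≡0 ⟩
    (m · 1# * 0#) * z    ≡⟨ solve 2 (λ m z → (m :* :0) :* z := :0) refl (m · 1#) z ⟩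
    0#                   ∎
    where
    open ≡-Reasoning

  -- A field has no zero divisors, so a vanishing power of `p · 1#` has a vanishing factor.
  characteristic : ∀ p m → (p ℕ.^ m) · 1# ≡ 0# → p · 1# ≡ 0#
  characteristic p zero    e = contradiction (trans (sym e) (+-identityʳ 1#)) 0≢1
  characteristic p (suc m) e with (p · 1#) ≟ 0#
  ... | yes p1≡0 = p1≡0
  ... | no p1≢0  = characteristic p m (*≡0⇒ p1≢0 (trans (sym (×1-homo-* p (p ℕ.^ m))) e))

  -- In the binomial expansion every coefficient except the two outer ones is divisible by p.
  frobenius : ∀ {p} → Prime p → p · 1# ≡ 0# → ∀ x y → (x + y) ^ p ≡ x ^ p + y ^ p
  frobenius {p@(suc p-1)} pp p1≡0 x y = begin
    (x + y) ^ p                                ≡⟨ theorem p x y ⟩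
    binomialExpansion x y p                    ≡⟨ cong (binomialTerm x y p zero +_)
        (sum-init-last (term ∘ suc)) ⟩
    binomialTerm x y p zero + (sum middle + term (suc (fromℕ p-1)))
      ≡⟨ cong₂ (λ a b → a + (b + term (suc (fromℕ p-1)))) first
          (trans (sum-cong-≋ middle≡0) (sum-replicate-zero p-1)) ⟩
    y ^ p + (0# + term (suc (fromℕ p-1)))      ≡⟨ cong (λ a → y ^ p + (0# + a)) final ⟩
    y ^ p + (0# + x ^ p)                       ≡⟨ solve 2 (λ a b → a :+ (:0 :+ b) := b :+ a) refl (y ^ p)
        (x ^ p) ⟩
    x ^ p + y ^ p                              ∎
    where
    open ≡-Reasoning
    open Algebra.Properties.CommutativeSemiring.Binomial commutativeSemiring using
        (theorem; binomialExpansion; binomialTerm)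
    open Algebra.Properties.CommutativeMonoid.Sum +-commutativeMonoid using
        (sum; sum-init-last; sum-cong-≋; sum-replicate-zero)
    term : Fin (suc p) → Carrier
    term = binomialTerm x y p
    middle : Fin p-1 → Carrier
    middle j = term (suc (inject₁ j))
    first : term zero ≡ y ^ p
    first = trans (+-identityʳ _) (*-identityˡ _)
    final : term (suc (fromℕ p-1)) ≡ x ^ p
    final rewrite Fin.toℕ-fromℕ p-1 | nCn≡1 p | ℕ.n∸n≡0 p-1 = trans (+-identityʳ _) (*-identityʳ _)
    middle≡0 : ∀ j → middle j ≡ 0#
    middle≡0 j = ·-vanish p p1≡0 (prime∣C pp (ℕ.s≤s ℕ.z≤n)
        (ℕ.s≤s (subst (ℕ._< p-1) (sym (Fin.toℕ-inject₁ j)) (Fin.toℕ<n j)))) _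

  frobenius-^ : ∀ {p} → Prime p → p · 1# ≡ 0# → ∀ k x y → (x + y) ^ (p ℕ.^ k) ≡ x ^ (p ℕ.^ k) + y ^ (p ℕ.^ k)
  frobenius-^ pp p1≡0 zero x y = solve 2 (λ x y → (x :+ y) :* :1 := x :* :1 :+ y :* :1) refl x y
  frobenius-^ {p} pp p1≡0 (suc k) x y = begin
    (x + y) ^ (p ℕ.* p ℕ.^ k)                          ≡⟨ ^-assocʳ (x + y) p (p ℕ.^ k) ⟨
    ((x + y) ^ p) ^ (p ℕ.^ k)                          ≡⟨ cong (_^ (p ℕ.^ k)) (frobenius pp p1≡0 x y) ⟩
    (x ^ p + y ^ p) ^ (p ℕ.^ k)                        ≡⟨ frobenius-^ pp p1≡0 k (x ^ p) (y ^ p) ⟩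
    (x ^ p) ^ (p ℕ.^ k) + (y ^ p) ^ (p ℕ.^ k)          ≡⟨ cong₂ _+_ (^-assocʳ x p (p ℕ.^ k))
        (^-assocʳ y p (p ℕ.^ k)) ⟩
    x ^ (p ℕ.* p ℕ.^ k) + y ^ (p ℕ.* p ℕ.^ k)          ∎
    where open ≡-Reasoning

  -- If 2 were 0, an odd multiple of 1 would be 1, not 0.
  odd⇒2≢0 : ∀ j → (1 ℕ.+ j ℕ.* 2) · 1# ≡ 0# → 1# + 1# ≢ 0#
  odd⇒2≢0 j e 2≡0 = 0≢1 (trans (sym e) (trans (cong (1# +_)
      (·-vanish 2 (trans (cong (1# +_) (+-identityʳ 1#)) 2≡0) (divides j refl) 1#)) (+-identityʳ 1#)))

-- Counting decidable subtypes, and a pigeonhole bound.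

Σ-≡ : ∀ {A : Set} {P : A → Set} → Irrelevant P → {x y : Σ A P} → proj₁ x ≡ proj₁ y → x ≡ y
Σ-≡ irr {x , p} {.x , p′} refl = cong (x ,_) (irr p p′)

-- Irrelevance of `P` makes every index contribute at most one element, so that the count ignores
-- the choice of proofs.
countFin : ∀ n {P : Fin n → Set} → Decidable P → Irrelevant P → ∃ λ m → Fin m ↔ Σ (Fin n) P
countFin zero P? irr = 0 , mk↔ₛ′ (λ ()) (λ ()) (λ ()) (λ ())
countFin (suc n) {P} P? irr with countFin n (P? ∘ suc) irr | P? zero
... | m , e | yes p = suc m , mk↔ₛ′ to from to-from from-to
  where
  module e = Inverse e
  to : Fin (suc m) → Σ (Fin (suc n)) P
  to zero    = zero , p
  to (suc i) = suc (proj₁ (e.to i)) , proj₂ (e.to i)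
  from : Σ (Fin (suc n)) P → Fin (suc m)
  from (zero  , _) = zero
  from (suc i , p) = suc (e.from (i , p))
  to-from : ∀ x → to (from x) ≡ x
  to-from (zero  , p) = Σ-≡ irr refl
  to-from (suc i , p) = Σ-≡ irr (cong (suc ∘ proj₁) (e.strictlyInverseˡ (i , p)))
  from-to : ∀ i → from (to i) ≡ i
  from-to zero    = refl
  from-to (suc i) = cong suc (e.strictlyInverseʳ i)
... | m , e | no ¬p = m , mk↔ₛ′ to from to-from e.strictlyInverseʳ
  where
  module e = Inverse e
  to : Fin m → Σ (Fin (suc n)) P
  to i = suc (proj₁ (e.to i)) , proj₂ (e.to i)
  from : Σ (Fin (suc n)) P → Fin m
  from (zero  , p) = contradiction p ¬p
  from (suc i , p) = e.from (i , p)
  to-from : ∀ x → to (from x) ≡ x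
  to-from (zero  , p) = contradiction p ¬p
  to-from (suc i , p) = Σ-≡ irr (cong (suc ∘ proj₁) (e.strictlyInverseˡ (i , p)))

count : ∀ {n} {A : Set} → Fin n ↔ A → {P : A → Set} → Decidable P → Irrelevant P → ∃ λ m → Fin m ↔ Σ A P
count {n} e {P} P? irr with countFin n (P? ∘ Inverse.to e) irr
... | m , e′ = m , (mk↔ₛ′ to from to-from from-to ↔-∘ e′)
  where
  module e = Inverse e
  to : Σ (Fin n) (P ∘ e.to) → Σ _ P
  to (i , p) = e.to i , p
  from : Σ _ P → Σ (Fin n) (P ∘ e.to)
  from (x , p) = e.from x , subst P (sym (e.strictlyInverseˡ x)) p
  to-from : ∀ x → to (from x) ≡ x
  to-from (x , p) = Σ-≡ irr (e.strictlyInverseˡ x)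
  from-to : ∀ x → from (to x) ≡ x
  from-to (i , p) = Σ-≡ irr (e.strictlyInverseʳ i)

²-injective : ∀ {m n} → m ℕ.* m ≡ n ℕ.* n → m ≡ n
²-injective {m} {n} e with ℕ.<-cmp m n
... | tri< m<n _ _ = contradiction e (ℕ.<⇒≢ (ℕ.*-mono-< m<n m<n))
... | tri≈ _ m≡n _ = m≡n
... | tri> _ _ n<m = contradiction (sym e) (ℕ.<⇒≢ (ℕ.*-mono-< n<m n<m))

-- As `f` misses `a`, the pair (f , g) takes at most (q - 1)(q + 1) = q² - 1 values.
no-injection : ∀ {q} (a : Fin q) (f : Fin (q ℕ.* q) → Fin q) (g : Fin (q ℕ.* q) → Fin (q ℕ.+ 1)) →
               (∀ i → a ≢ f i) → (∀ {i j} → f i ≡ f j → g i ≡ g j → i ≡ j) → ⊥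
no-injection {suc m} a f g a≢f inj with Fin.pigeonhole few h
  where
  h : Fin (suc m ℕ.* suc m) → Fin (m ℕ.* (suc m ℕ.+ 1))
  h i = combine (punchOut (a≢f i)) (g i)
  few : m ℕ.* (suc m ℕ.+ 1) ℕ.< suc m ℕ.* suc m
  few = ℕ.≤-reflexive (size m)
    where
    size : ∀ m → suc (m ℕ.* (suc m ℕ.+ 1)) ≡ suc m ℕ.* suc m
    size = solve-∀
... | i , j , i<j , e with Fin.combine-injective (punchOut (a≢f i)) (g i) (punchOut (a≢f j)) (g j) e
...   | f≡ , g≡ = Fin.<⇒≢ i<j (inj (Fin.punchOut-injective (a≢f i) (a≢f j) f≡) g≡)

from-injective : ∀ {A B : Set} (e : A ↔ B) {x y} → Inverse.from e x ≡ Inverse.from e y → x ≡ y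
from-injective e = Injection.injective (↔⇒↣ (↔-sym e))

-- Conjugation x ↦ x^q and the decomposition over the basis 1, β.

module NumericalRange
  (q : ℕ) (q-odd : OddPrimePower q) (L : Field) (enum : Fin (q ℕ.* q) ↔ Field.Carrier L)
  (β : Field.Carrier L) (α∈Fq : Setup.InFq L q β (Setup.α L q β))
  (α-nonsquare : ¬ (Σ (Field.Carrier L) λ y → Setup.InFq L q β y × Field._*_ L y y ≡ Setup.α L q β))
  where

  open FieldProperties L
  open FiniteFieldProperties L enum using (_≟_)
  open Setup L q β
    using (C; _-_; pow; conj; InFq; α; two; Mat; eval; ∂; entry; FA; idM; ReM; ImM; _·_; ⟨_,_⟩
          ; NonSingular; InDual; InS; InU; _~U_; CardS; CardOrbits)
  private
    open FiniteFieldProperties L enum hiding (_≟_)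
    open Algebra.Properties.CommutativeSemiring.Exp commutativeSemiring
      using (_^_; ^-assocʳ; ^-distrib-*)
    open Algebra.Properties.Semiring.Mult semiring using (×1-homo-*) renaming (_×_ to _×ₙ_)

    char = proj₁ q-odd
    exponent = proj₁ (proj₂ q-odd)
    p-prime = proj₁ (proj₂ (proj₂ q-odd))
    char≢2 = proj₁ (proj₂ (proj₂ (proj₂ q-odd)))
    q≡ : q ≡ char ℕ.^ suc exponent
    q≡ = proj₂ (proj₂ (proj₂ (proj₂ q-odd)))

    -- The square of q · 1 is q² · 1, which vanishes because the field has q² elements.
    q·1≡0 : q ×ₙ 1# ≡ 0#
    q·1≡0 with (q ×ₙ 1#) ≟ 0#
    ... | yes e = e
    ... | no ≢0 = *≡0⇒ ≢0 (trans (sym (×1-homo-* q q)) card·1≡0)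

    char·1≡0 : char ×ₙ 1# ≡ 0#
    char·1≡0 = characteristic char (suc exponent) (trans (cong (_×ₙ 1#) (sym q≡)) q·1≡0)

    pow≡^ : ∀ x n → pow x n ≡ x ^ n
    pow≡^ x zero    = refl
    pow≡^ x (suc n) = cong (x *_) (pow≡^ x n)

    conj≡^ : ∀ x → conj x ≡ x ^ q
    conj≡^ x = pow≡^ x q

  two≢0 : two ≢ 0#
  two≢0 with oddPrime p-prime char≢2
  ... | j , char≡ = odd⇒2≢0 j (trans (cong (_×ₙ 1#) (sym char≡)) char·1≡0)

  conj-+ : ∀ x y → conj (x + y) ≡ conj x + conj y
  conj-+ x y = begin
    conj (x + y)                 ≡⟨ conj≡^ (x + y) ⟩
    (x + y) ^ q                  ≡⟨ cong ((x + y) ^_) q≡ ⟩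
    (x + y) ^ (char ℕ.^ suc exponent)      ≡⟨ frobenius-^ p-prime char·1≡0 (suc exponent) x y ⟩
    x ^ (char ℕ.^ suc exponent) + y ^ (char ℕ.^ suc exponent) ≡⟨ cong (λ n → x ^ n + y ^ n) q≡ ⟨
    x ^ q + y ^ q                ≡⟨ cong₂ _+_ (conj≡^ x) (conj≡^ y) ⟨
    conj x + conj y              ∎
    where open ≡-Reasoning

  conj-* : ∀ x y → conj (x * y) ≡ conj x * conj y
  conj-* x y = begin
    conj (x * y)        ≡⟨ conj≡^ (x * y) ⟩
    (x * y) ^ q         ≡⟨ ^-distrib-* x y q ⟩
    x ^ q * y ^ q       ≡⟨ cong₂ _*_ (conj≡^ x) (conj≡^ y) ⟨
    conj x * conj y     ∎
    where open ≡-Reasoning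

  conj-conj : ∀ x → conj (conj x) ≡ x
  conj-conj x = begin
    conj (conj x)       ≡⟨ conj≡^ (conj x) ⟩
    conj x ^ q          ≡⟨ cong (_^ q) (conj≡^ x) ⟩
    (x ^ q) ^ q         ≡⟨ ^-assocʳ x q q ⟩
    x ^ (q ℕ.* q)       ≡⟨ ^-card x ⟩
    x                   ∎
    where open ≡-Reasoning

  conj-0 : conj 0# ≡ 0#
  conj-0 = modulo₁ (- 1#) (trans (cong conj (sym (+-identityˡ 0#))) (conj-+ 0# 0#))
    (solve 1 (λ z → z :+ (:- :1) :* (z :+ z) := :0 :+ (:- :1) :* z) refl (conj 0#))

  conj-1 : conj 1# ≡ 1#
  conj-1 = go q
    where
    go : ∀ n → pow 1# n ≡ 1#
    go zero    = refl
    go (suc n) = trans (*-identityˡ _) (go n)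

  conj-neg : ∀ x → conj (- x) ≡ - conj x
  conj-neg x = modulo₁ (- 1#) (trans (sym conj-0) (trans (cong conj (sym (-‿inverseʳ x))) (conj-+ x (- x))))
    (solve 2 (λ a b → b :+ (:- :1) :* (a :+ b) := :- a :+ (:- :1) :* :0) refl (conj x) (conj (- x)))

  conj-- : ∀ x y → conj (x - y) ≡ conj x - conj y
  conj-- x y = trans (conj-+ x (- y)) (cong (conj x +_) (conj-neg y))

  conj-≢0 : ∀ {x} → x ≢ 0# → conj x ≢ 0#
  conj-≢0 x≢0 e = x≢0 (trans (sym (conj-conj _)) (trans (cong conj e) conj-0))

  conj-injective : ∀ {x y} → conj x ≡ conj y → x ≡ y
  conj-injective e = trans (sym (conj-conj _)) (trans (cong conj e) (conj-conj _))

  conj-two : conj two ≡ two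
  conj-two = trans (conj-+ 1# 1#) (cong₂ _+_ conj-1 conj-1)

  conj-inv : ∀ {x} → x ≢ 0# → conj (inv x) ≡ inv (conj x)
  conj-inv {x} x≢0 = *-cancelˡ _ _ (conj-≢0 x≢0)
    (trans (sym (conj-* x (inv x))) (trans (cong conj (inv-r x x≢0))
      (trans conj-1 (sym (inv-r _ (conj-≢0 x≢0))))))

  β≢0 : β ≢ 0#
  β≢0 refl = α-nonsquare (0# , conj-0 , refl)

  -- Conjugation fixes β² = α, so it sends β to β or - β; the first would make β a square root of α
  -- in F_q.
  conj-β : conj β ≡ - β
  conj-β with (conj β - β) ≟ 0#
  ... | yes e = contradiction (β , (modulo₁ 1# e (solve 2
      (λ c b → c :+ :1 :* :0 := b :+ :1 :* (c :- b)) refl (conj β) β)) , refl) α-nonsquare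
  ... | no ≢0 = modulo₁ 1# (*≡0⇒ ≢0 (modulo₁ 1# (trans (sym (conj-* β β)) α∈Fq)
      (solve 2 (λ c b → (c :- b) :* (c :+ b) :+ :1 :* (b :* b) := :0 :+ :1 :* (c :* c)) refl (conj β) β)))
    (solve 2 (λ c b → c :+ :1 :* :0 := :- b :+ :1 :* (c :+ b)) refl (conj β) β)

  half halfβ : C
  half  = inv two
  halfβ = inv (two * β)

  re im : C → C
  re x = (x + conj x) * half
  im x = (x - conj x) * halfβ

  twoβ≢0 : two * β ≢ 0#
  twoβ≢0 = *-≢0 two≢0 β≢0

  conj-half : conj half ≡ half
  conj-half = trans (conj-inv two≢0) (cong inv conj-two)

  conj-twoβ : conj (two * β) ≡ - (two * β)
  conj-twoβ = trans (conj-* two β) (trans (cong₂ _*_ conj-two conj-β)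
    (solve 2 (λ t b → t :* (:- b) := :- (t :* b)) refl two β))

  conj-halfβ : conj halfβ ≡ - halfβ
  conj-halfβ = *-cancelˡ _ _ twoβ≢0 (modulo₂ (- 1#) conjugated 1# (inv-r _ twoβ≢0)
    (solve 3 (λ t i c → t :* c :+ (:- :1) :* :1 :+ :1 :* :1
                     := t :* (:- i) :+ (:- :1) :* ((:- t) :* c) :+ :1 :* (t :* i))
      refl (two * β) halfβ (conj halfβ)))
    where
    open ≡-Reasoning
    conjugated : (- (two * β)) * conj halfβ ≡ 1#
    conjugated = begin
      (- (two * β)) * conj halfβ     ≡⟨ cong (_* conj halfβ) conj-twoβ ⟨
      conj (two * β) * conj halfβ    ≡⟨ conj-* (two * β) halfβ ⟨
      conj (two * β * halfβ)         ≡⟨ cong conj (inv-r _ twoβ≢0) ⟩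
      conj 1#                        ≡⟨ conj-1 ⟩
      1#                             ∎

  re+βim : ∀ x → re x + β * im x ≡ x
  re+βim x = *-cancelˡ _ _ two≢0 (modulo₂ (x + conj x) (inv-r _ two≢0) (x - conj x) (inv-r _ twoβ≢0)
    (solve 5 (λ x c b i j → :2 :* ((x :+ c) :* i :+ b :* ((x :- c) :* j)) :+ (x :+ c) :* :1 :+ (x :- c) :* :1
                         := :2 :* x :+ (x :+ c) :* (:2 :* i) :+ (x :- c) :* (:2 :* b :* j))
      refl x (conj x) β half halfβ))

  re∈Fq : ∀ x → InFq (re x)
  re∈Fq x = trans (conj-* _ half) (cong₂ _*_
    (trans (conj-+ x (conj x)) (trans (cong (conj x +_) (conj-conj x)) (+-comm _ _))) conj-half)

  im∈Fq : ∀ x → InFq (im x)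
  im∈Fq x = trans (conj-* _ halfβ) (trans (cong₂ _*_ (trans (conj-- x (conj x))
      (cong (λ s → conj x - s) (conj-conj x))) conj-halfβ)
    (solve 3 (λ x c j → (c :- x) :* (:- j) := (x :- c) :* j) refl x (conj x) halfβ))

  conj-k+βl : ∀ {k l} → InFq k → InFq l → conj (k + β * l) ≡ k - β * l
  conj-k+βl {k} {l} k∈ l∈ = trans (conj-+ k (β * l)) (cong₂ _+_ k∈
      (trans (conj-* β l) (trans (cong₂ _*_ conj-β l∈)
    (solve 2 (λ b l → (:- b) :* l := :- (b :* l)) refl β l))))

  re-k+βl : ∀ {k l} → InFq k → InFq l → re (k + β * l) ≡ k
  re-k+βl {k} {l} k∈ l∈ = trans (cong (λ t → (k + β * l + t) * half) (conj-k+βl k∈ l∈))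
    (modulo₁ k (inv-r _ two≢0) (solve 4 (λ k l b i → (k :+ b :* l :+ (k :- b :* l)) :* i :+ k :* :1
        := k :+ k :* (:2 :* i)) refl k l β half))

  im-k+βl : ∀ {k l} → InFq k → InFq l → im (k + β * l) ≡ l
  im-k+βl {k} {l} k∈ l∈ = trans (cong (λ t → (k + β * l - t) * halfβ) (conj-k+βl k∈ l∈))
    (modulo₁ l (inv-r _ twoβ≢0) (solve 4 (λ k l b i → (k :+ b :* l :- (k :- b :* l)) :* i :+ l :* :1
        := l :+ l :* (:2 :* b :* i)) refl k l β halfβ))

  -- The norm: sizes of F_q and of the unitary group, and surjectivity.

  norm : C → C
  norm x = x * conj x

  norm∈Fq : ∀ x → InFq (norm x)
  norm∈Fq x = trans (conj-* x (conj x)) (trans (cong (conj x *_) (conj-conj x)) (*-comm _ _))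

  norm≡0⇒≡0 : ∀ {x} → norm x ≡ 0# → x ≡ 0#
  norm≡0⇒≡0 {x} e with x ≟ 0#
  ... | yes x≡0 = x≡0
  ... | no x≢0  = contradiction e (*-≢0 x≢0 (conj-≢0 x≢0))

  norm-* : ∀ x y → norm (x * y) ≡ norm x * norm y
  norm-* x y = trans (cong (x * y *_) (conj-* x y))
    (solve 4 (λ x y c d → x :* y :* (c :* d) := x :* c :* (y :* d)) refl x y (conj x) (conj y))

  -- Both are subtypes cut out by a single equation, hence by an irrelevant predicate, so they can
  -- be counted. `InU` carries coordinates and is compared with norm 1 later.
  Fq Unitary : Set
  Fq      = Σ C InFq
  Unitary = Σ C λ w → norm w ≡ 1#

  Fq-≡ : {x y : Fq} → proj₁ x ≡ proj₁ y → x ≡ y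
  Fq-≡ = Σ-≡ ≡-irrelevant

  Unitary-≡ : {x y : Unitary} → proj₁ x ≡ proj₁ y → x ≡ y
  Unitary-≡ = Σ-≡ ≡-irrelevant

  coordinates : (Fq × Fq) ↔ C
  coordinates = mk↔ₛ′ to from re+βim from-to
    where
    to : Fq × Fq → C
    to ((k , _) , (l , _)) = k + β * l
    from : C → Fq × Fq
    from x = (re x , re∈Fq x) , (im x , im∈Fq x)
    from-to : ∀ x → from (to x) ≡ x
    from-to ((k , k∈) , (l , l∈)) =
      cong₂ _,_ (Fq-≡ {re (k + β * l) , re∈Fq (k + β * l)} {k , k∈} (re-k+βl k∈ l∈))
                (Fq-≡ {im (k + β * l) , im∈Fq (k + β * l)} {l , l∈} (im-k+βl k∈ l∈))

  -- The fixed points of conjugation have some cardinality m, and L ≅ F_q × F_q gives m² = q².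
  Fin-Fq : Fin q ↔ Fq
  Fin-Fq with count enum {InFq} (λ x → conj x ≟ x) ≡-irrelevant
  ... | m , e = subst (λ m → Fin m ↔ Fq) (²-injective (↔⇒≡ squares)) e
    where
    squares : Fin (m ℕ.* m) ↔ Fin (q ℕ.* q)
    squares = ↔-sym enum ↔-∘ (coordinates ↔-∘ ((e ×-↔ e) ↔-∘ Fin.*↔×))

  -- The rational parametrisation of the conic k² − α l² = 1 from the point −1.
  unitaries : (Fq ⊎ Fin 1) ↔ Unitary
  unitaries = mk↔ₛ′ to from to-from from-to
    where
    conj-1-βt : ∀ {t} → InFq t → conj (1# - β * t) ≡ 1# + β * t
    conj-1-βt {t} t∈ = trans (conj-- 1# (β * t)) (trans
        (cong₂ _-_ conj-1 (trans (conj-* β t) (cong₂ _*_ conj-β t∈)))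
      (solve 2 (λ b t → :1 :- (:- b) :* t := :1 :+ b :* t) refl β t))

    -- If 1 - βt vanished, so would its conjugate 1 + βt, and hence their sum 2.
    1-βt≢0 : ∀ {t} → InFq t → 1# - β * t ≢ 0#
    1-βt≢0 {t} t∈ e = two≢0 (modulo₂ 1# e 1# (trans (sym (conj-1-βt t∈)) (trans (cong conj e) conj-0))
      (solve 2 (λ b t → :2 :+ :1 :* :0 :+ :1 :* :0 := :0 :+ :1 :* (:1 :- b :* t) :+ :1 :* (:1 :+ b :* t))
          refl β t))

    point : C → C
    point t = (1# + β * t) * inv (1# - β * t)

    norm-point : ∀ {t} → InFq t → norm (point t) ≡ 1#
    norm-point {t} t∈ = trans (cong (point t *_) conj-point)
      (modulo₂ ((1# + β * t) * inv (1# + β * t)) (inv-r _ (1-βt≢0 t∈)) 1# (inv-r _ 1+βt≢0)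
        (solve 4 (λ a d i j → (a :* i) :* (d :* j) :+ (a :* j) :* :1 :+ :1 :* :1 := :1 :+ (a :* j) :*
            (d :* i) :+ :1 :* (a :* j))
          refl (1# + β * t) (1# - β * t) (inv (1# - β * t)) (inv (1# + β * t))))
      where
      1+βt≢0 : 1# + β * t ≢ 0#
      1+βt≢0 e = 1-βt≢0 t∈ (conj-injective (trans (conj-1-βt t∈) (trans e (sym conj-0))))
      conj-point : conj (point t) ≡ (1# - β * t) * inv (1# + β * t)
      conj-point = trans (conj-* _ _) (cong₂ _*_ (conj-k+βl conj-1 t∈)
          (trans (conj-inv (1-βt≢0 t∈)) (cong inv (conj-1-βt t∈))))

    parameter : C → C
    parameter w = (w - 1#) * inv (β * (w + 1#))

    w+1≢0 : ∀ {w} → w ≢ - 1# → w + 1# ≢ 0#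
    w+1≢0 {w} w≢-1 e = w≢-1 (modulo₁ 1# e (solve 1 (λ w → w :+ :1 :* :0 := :- :1 :+ :1 :* (w :+ :1)) refl w))

    -- Because w̄ = 1/w, conjugation fixes (w - 1) / (β(w + 1)): with the denominators cleared, the
    -- two sides differ by 2β(w w̄ - 1).
    parameter∈Fq : ∀ {w} → norm w ≡ 1# → w ≢ - 1# → InFq (parameter w)
    parameter∈Fq {w} ww̄≡1 w≢-1 = trans (trans (conj-* _ _)
        (cong₂ _*_ (trans (conj-- w 1#) (cong (λ s → conj w - s) conj-1)) (conj-inv d≢0)))
      (*-cancelˡ _ _ (*-≢0 d≢0 (conj-≢0 d≢0)) (modulo₃ (- ((w - 1#) * conj d)) (inv-r d d≢0)
          (d * (conj w - 1#)) (inv-r (conj d) (conj-≢0 d≢0)) (two * β) ww̄≡1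
        (trans (cong (λ e → d * e * ((conj w - 1#) * inv (conj d)) + (- ((w - 1#) * e)) * 1# + d *
            (conj w - 1#) * 1# + (two * β) * 1#) conj-d)
        (trans (solve 5 (λ w c b i j → let d = b :* (w :+ :1); e = (:- b) :* (c :+ :1) in
          d :* e :* ((c :- :1) :* j) :+ (:- ((w :- :1) :* e)) :* :1 :+ d :* (c :- :1) :* :1 :+ (:2 :* b) :* :1
          := d :* e :* ((w :- :1) :* i) :+ (:- ((w :- :1) :* e)) :* (d :* i) :+ d :* (c :- :1) :*
              (e :* j) :+ (:2 :* b) :* (w :* c)) refl w (conj w) β (inv d) (inv (conj d)))
          (cong (λ e → d * e * ((w - 1#) * inv d) + (- ((w - 1#) * e)) * (d * inv d) + d * (conj w - 1#) *
              (e * inv (conj d)) + (two * β) * (w * conj w)) (sym conj-d))))))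
      where
      d = β * (w + 1#)
      d≢0 = *-≢0 β≢0 (w+1≢0 w≢-1)
      conj-d : conj d ≡ (- β) * (conj w + 1#)
      conj-d = trans (conj-* β (w + 1#)) (cong₂ _*_ conj-β (trans (conj-+ w 1#) (cong (conj w +_) conj-1)))

    point≢-1 : ∀ {t} → InFq t → point t ≢ - 1#
    point≢-1 {t} t∈ e = two≢0 (modulo₂ (1# - β * t) e (- (1# + β * t)) (inv-r _ (1-βt≢0 t∈))
      (solve 3 (λ b t i → :2 :+ (:1 :- b :* t) :* (:- :1) :+ (:- (:1 :+ b :* t)) :* :1
                       := :0 :+ (:1 :- b :* t) :* ((:1 :+ b :* t) :* i) :+ (:- (:1 :+ b :* t)) :*
                           ((:1 :- b :* t) :* i))
        refl β t (inv (1# - β * t))))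

    to : Fq ⊎ Fin 1 → Unitary
    to (inj₁ (t , t∈)) = point t , norm-point t∈
    to (inj₂ _)        = - 1# , trans (cong ((- 1#) *_) (trans (conj-neg 1#) (cong -_ conj-1)))
                                      (solve 0 ((:- :1) :* (:- :1) := :1) refl)

    point-parameter : ∀ {w} → norm w ≡ 1# → w ≢ - 1# → point (parameter w) ≡ w
    point-parameter {w} e w≢-1 = *-cancelˡ _ _ (1-βt≢0 (parameter∈Fq e w≢-1))
        (modulo₂ (1# + β * parameter w) (inv-r _ (1-βt≢0 (parameter∈Fq e w≢-1))) (w - 1#) (inv-r _ d≢0)
          (solve 4 (λ w b i j → let t = (w :- :1) :* i in
               (:1 :- b :* t) :* ((:1 :+ b :* t) :* j) :+ (:1 :+ b :* t) :* :1 :+ (w :- :1) :* :1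
            := (:1 :- b :* t) :* w :+ (:1 :+ b :* t) :* ((:1 :- b :* t) :* j) :+ (w :- :1) :*
                (b :* (w :+ :1) :* i))
            refl w β (inv (β * (w + 1#))) (inv (1# - β * parameter w))))
      where
      d≢0 : β * (w + 1#) ≢ 0#
      d≢0 = *-≢0 β≢0 (w+1≢0 w≢-1)

    parameter-point : ∀ {t} → InFq t → parameter (point t) ≡ t
    parameter-point {t} t∈ = *-cancelˡ _ _ d≢0
      (modulo₂ (point t - 1#) (inv-r _ d≢0) (1# + β * t) (inv-r _ (1-βt≢0 t∈))
        (solve 4 (λ t b i j → let w = (:1 :+ b :* t) :* i; d = b :* (w :+ :1) in
             d :* ((w :- :1) :* j) :+ (w :- :1) :* :1 :+ (:1 :+ b :* t) :* :1
          := d :* t :+ (w :- :1) :* (d :* j) :+ (:1 :+ b :* t) :* ((:1 :- b :* t) :* i))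
          refl t β (inv (1# - β * t)) (inv (β * (point t + 1#)))))
      where
      d≢0 : β * (point t + 1#) ≢ 0#
      d≢0 = *-≢0 β≢0 (w+1≢0 (point≢-1 t∈))

    -- The decision is an argument, so the inverse laws can be proved by matching on an arbitrary
    -- decision instead of unfolding `_≟_`.
    fromDec : ∀ w → norm w ≡ 1# → Dec (w ≡ - 1#) → Fq ⊎ Fin 1
    fromDec w e (yes _)   = inj₂ zero
    fromDec w e (no w≢-1) = inj₁ (parameter w , parameter∈Fq e w≢-1)

    from : Unitary → Fq ⊎ Fin 1
    from (w , e) = fromDec w e (w ≟ (- 1#))

    to-fromDec : ∀ w e d → to (fromDec w e d) ≡ (w , e)
    to-fromDec w e (yes w≡-1) = Unitary-≡ (sym w≡-1)
    to-fromDec w e (no w≢-1)  = Unitary-≡ (point-parameter e w≢-1)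

    fromDec-point : ∀ t t∈ e d → fromDec (point t) e d ≡ inj₁ (t , t∈)
    fromDec-point t t∈ e (yes ≡-1) = contradiction ≡-1 (point≢-1 t∈)
    fromDec-point t t∈ e (no ≢-1)  = cong inj₁ (Fq-≡ {parameter (point t) , parameter∈Fq e ≢-1} {t , t∈}
        (parameter-point t∈))

    fromDec--1 : ∀ e d → fromDec (- 1#) e d ≡ inj₂ zero
    fromDec--1 e (yes _) = refl
    fromDec--1 e (no ≢)  = contradiction refl ≢

    to-from : ∀ w → to (from w) ≡ w
    to-from (w , e) = to-fromDec w e (w ≟ (- 1#))

    from-to : ∀ x → from (to x) ≡ x
    from-to (inj₁ (t , t∈)) = fromDec-point t t∈ (norm-point t∈) (point t ≟ (- 1#))
    from-to (inj₂ zero)     = fromDec--1 _ ((- 1#) ≟ (- 1#))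

  Fin-Unitary : Fin (q ℕ.+ 1) ↔ Unitary
  Fin-Unitary = unitaries ↔-∘ ((Fin-Fq ⊎-↔ ↔-refl) ↔-∘ Fin.+↔⊎)

  isNorm? : ∀ b → Dec (∃ λ x → norm x ≡ b)
  isNorm? b = map′ (λ (i , e) → Inverse.to enum i , e)
    (λ (x , e) → Inverse.from enum x , trans (cong norm (Inverse.strictlyInverseˡ enum x)) e)
    (Fin.any? λ i → norm (Inverse.to enum i) ≟ b)

  -- A section of the norm over its image; the default 0# stands only for values that are not norms.
  normSection : C → C
  normSection b with isNorm? b
  ... | yes (x , _) = x
  ... | no _        = 0#

  norm-normSection : ∀ x → norm (normSection (norm x)) ≡ norm x
  norm-normSection x with isNorm? (norm x)
  ... | yes (_ , e)  = e
  ... | no notNorm   = contradiction (x , refl) notNorm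

  -- The unitary part of a polar form whose radial part is the chosen section. At 0 the value serves
  -- only to have norm 1.
  angle : C → C
  angle x with x ≟ 0#
  ... | yes _ = 1#
  ... | no _  = x * inv (normSection (norm x))

  normSection≢0 : ∀ {x} → x ≢ 0# → normSection (norm x) ≢ 0#
  normSection≢0 {x} x≢0 e = *-≢0 x≢0 (conj-≢0 x≢0)
    (trans (sym (norm-normSection x)) (trans (cong norm e) (zeroˡ _)))

  norm-angle : ∀ x → norm (angle x) ≡ 1#
  norm-angle x with x ≟ 0#
  ... | yes _  = trans (*-identityˡ _) conj-1
  ... | no x≢0 = begin
    norm (x * inv s)          ≡⟨ norm-* x (inv s) ⟩
    norm x * norm (inv s)     ≡⟨ cong (_* norm (inv s)) (norm-normSection x) ⟨
    norm s * norm (inv s)     ≡⟨ norm-* s (inv s) ⟨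
    norm (s * inv s)          ≡⟨ cong norm (inv-r s (normSection≢0 x≢0)) ⟩
    norm 1#                   ≡⟨ *-identityˡ _ ⟩
    conj 1#                   ≡⟨ conj-1 ⟩
    1#                        ∎
    where
    open ≡-Reasoning
    s = normSection (norm x)

  -- Equal norms mean that both angles divide by the same section value, which then cancels; the
  -- element 0 is recognised by its norm alone.
  polar-injective : ∀ {x y} → norm x ≡ norm y → angle x ≡ angle y → x ≡ y
  polar-injective {x} {y} n≡ a≡ with x ≟ 0# | y ≟ 0#
  ... | yes x≡0 | yes y≡0 = trans x≡0 (sym y≡0)
  ... | yes x≡0 | no y≢0 = contradiction (norm≡0⇒≡0 (trans (sym n≡) (trans (cong norm x≡0) (zeroˡ _)))) y≢0
  ... | no x≢0 | yes y≡0 = contradiction (norm≡0⇒≡0 (trans n≡ (trans (cong norm y≡0) (zeroˡ _)))) x≢0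
  ... | no x≢0 | no _ = *-cancelˡ x y is≢0 (trans (*-comm _ x)
      (trans a≡ (trans (cong (λ n → y * inv (normSection n)) (sym n≡)) (*-comm y _))))
    where
    s≢0 = normSection≢0 x≢0
    is≢0 : inv (normSection (norm x)) ≢ 0#
    is≢0 e = 0≢1 (trans (sym (zeroʳ _)) (trans (cong (normSection (norm x) *_) (sym e)) (inv-r _ s≢0)))

  -- If a ∈ Fq were not a norm, then x ↦ (norm x , x / s (norm x)), with s a section of the norm
  -- onto its image, would embed the q² elements of L into a set of size (q − 1)(q + 1).
  norm-surjective : ∀ {a} → InFq a → ∃ λ x → norm x ≡ a
  norm-surjective {a} a∈ with isNorm? a
  ... | yes x         = x
  ... | no a-notNorm  = ⊥-elim impossible
    where
    normIndex : C → Fin q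
    normIndex x = Inverse.from Fin-Fq (norm x , norm∈Fq x)

    angleIndex : C → Fin (q ℕ.+ 1)
    angleIndex x = Inverse.from Fin-Unitary (angle x , norm-angle x)

    aIndex : Fin q
    aIndex = Inverse.from Fin-Fq (a , a∈)

    impossible : ⊥
    impossible = no-injection aIndex (normIndex ∘ Inverse.to enum) (angleIndex ∘ Inverse.to enum)
      (λ i e → a-notNorm (Inverse.to enum i , sym (cong proj₁ (from-injective Fin-Fq e))))
      (λ n≡ a≡ → Injection.injective (↔⇒↣ enum)
        (polar-injective (cong proj₁ (from-injective Fin-Fq n≡)) (cong proj₁ (from-injective Fin-Unitary a≡))))

  -- The base polynomial and its gradient in adapted coordinates.

  #0 #1 : Fin 2
  #0 = zero
  #1 = suc zero

  X Y T : Fin 3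
  X = zero
  Y = suc zero
  T = suc (suc zero)

  re+im≡ : ∀ a b → (a + b) * half + β * ((a - b) * halfβ) ≡ a
  re+im≡ a b = *-cancelˡ _ _ two≢0 (modulo₂ (a + b) (inv-r _ two≢0) (a - b) (inv-r _ twoβ≢0)
    (solve 5 (λ a b β i j → :2 :* ((a :+ b) :* i :+ β :* ((a :- b) :* j)) :+ (a :+ b) :* :1 :+ (a :- b) :* :1
                         := :2 :* a :+ (a :+ b) :* (:2 :* i) :+ (a :- b) :* (:2 :* β :* j))
      refl a b β half halfβ))

  re-im≡ : ∀ a b → (a + b) * half - β * ((a - b) * halfβ) ≡ b
  re-im≡ a b = *-cancelˡ _ _ two≢0 (modulo₂ (a + b) (inv-r _ two≢0) (b - a) (inv-r _ twoβ≢0)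
    (solve 5 (λ a b β i j → :2 :* ((a :+ b) :* i :- β :* ((a :- b) :* j)) :+ (a :+ b) :* :1 :+ (b :- a) :* :1
                         := :2 :* b :+ (a :+ b) :* (:2 :* i) :+ (b :- a) :* (:2 :* β :* j))
      refl a b β half halfβ))

  -- In the coordinates s = x/2 + y/(2β), s′ = x/2 − y/(2β) the matrix x H₁ + y H₂ + t I is s A + s′ A* + t I.
  point : C → C → C → Vec C 3
  point s s′ t = (s + s′) ∷ β * (s - s′) ∷ t ∷ []

  point-surjective : ∀ p → ∃ λ s → ∃ λ s′ → ∃ λ t → p ≡ point s s′ t
  point-surjective (x ∷ y ∷ t ∷ []) = x * half + y * halfβ , x * half - y * halfβ , t ,
    cong₂ (λ x y → x ∷ y ∷ t ∷ []) x≡ y≡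
    where
    x≡ : x ≡ x * half + y * halfβ + (x * half - y * halfβ)
    x≡ = modulo₁ (- x) (inv-r _ two≢0)
      (solve 4 (λ x y i j → x :+ (:- x) :* :1 := x :* i :+ y :* j :+ (x :* i :- y :* j) :+ (:- x) :*
          (:2 :* i)) refl x y half halfβ)
    y≡ : y ≡ β * (x * half + y * halfβ - (x * half - y * halfβ))
    y≡ = modulo₁ (- y) (inv-r _ twoβ≢0)
      (solve 5 (λ x y i j b → y :+ (:- y) :* :1 := b :* (x :* i :+ y :* j :- (x :* i :- y :* j)) :+
          (:- y) :* (:2 :* b :* j)) refl x y half halfβ β)

  module _ (A : Mat 2) (s s′ t : C) where
    eval-entry : ∀ i j → eval (point s s′ t) (entry A i j) ≡ s * A i j + s′ * conj (A j i) + t * idM i j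
    eval-entry i j = cong (_+ t * idM i j) (begin
      (s + s′) * h + β * (s - s′) * k
        ≡⟨ solve 5 (λ s s′ h b k → (s :+ s′) :* h :+ b :* (s :- s′) :* k
             := s :* (h :+ b :* k) :+ s′ :* (h :- b :* k)) refl s s′ h β k ⟩
      s * (h + β * k) + s′ * (h - β * k)
        ≡⟨ cong₂ (λ a b → s * a + s′ * b) (re+im≡ (A i j) (conj (A j i))) (re-im≡ (A i j) (conj (A j i))) ⟩
      s * A i j + s′ * conj (A j i) ∎)
      where
      open ≡-Reasoning
      h k : C
      h = ReM A i j
      k = ImM A i j

    ∂X-entry : ∀ i j → eval (point s s′ t) (∂ X (entry A i j)) ≡ ReM A i j
    ∂X-entry i j = solve 6 (λ h k e x y t → ((:1 :* h :+ x :* :0) :+ (:0 :* k :+ y :* :0)) :+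
        (:0 :* e :+ t :* :0) := h)
      refl (ReM A i j) (ImM A i j) (idM i j) (s + s′) (β * (s - s′)) t

    ∂Y-entry : ∀ i j → eval (point s s′ t) (∂ Y (entry A i j)) ≡ ImM A i j
    ∂Y-entry i j = solve 6 (λ h k e x y t → ((:0 :* h :+ x :* :0) :+ (:1 :* k :+ y :* :0)) :+
        (:0 :* e :+ t :* :0) := k)
      refl (ReM A i j) (ImM A i j) (idM i j) (s + s′) (β * (s - s′)) t

    ∂T-entry : ∀ i j → eval (point s s′ t) (∂ T (entry A i j)) ≡ idM i j
    ∂T-entry i j = solve 6 (λ h k e x y t → ((:0 :* h :+ x :* :0) :+ (:0 :* k :+ y :* :0)) :+
        (:1 :* e :+ t :* :0) := e)
      refl (ReM A i j) (ImM A i j) (idM i j) (s + s′) (β * (s - s′)) t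

  -- The polarisation of the determinant.
  polar : (a b c d a′ b′ c′ d′ : C) → C
  polar a b c d a′ b′ c′ d′ = (a * d′ + a′ * d) + (- (b * c′ + b′ * c))

  -- A partial derivative of `FA A` evaluates by definition to `polar` of the differentiated entries
  -- and the entries, so this congruence rewrites a gradient entry by entry.
  polar-cong : ∀ {a b c d a′ b′ c′ d′ e f g h e′ f′ g′ h′} → a ≡ e → b ≡ f → c ≡ g → d ≡ h →
               a′ ≡ e′ → b′ ≡ f′ → c′ ≡ g′ → d′ ≡ h′ → polar a b c d a′ b′ c′ d′ ≡ polar e f g h e′ f′ g′ h′
  polar-cong refl refl refl refl refl refl refl refl = refl

  -- The four equations say that A - λ₀ is the rank one product of the column w and the row (u₂ , -
  -- u₁).
  module Rank1
    (A : Mat 2) (λ₀ u₁ u₂ w₁ w₂ : C)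
    (A₀₀ : A #0 #0 ≡ λ₀ + w₁ * u₂) (A₀₁ : A #0 #1 ≡ - (w₁ * u₁))
    (A₁₀ : A #1 #0 ≡ w₂ * u₂) (A₁₁ : A #1 #1 ≡ λ₀ - w₂ * u₁)
    where

    -- `δ` is the trace of A - λ₀, so λ₀ + δ is the other eigenvalue; `m` is ⟨w,u⟩.
    δ δ̄ m N : C
    δ  = w₁ * u₂ - w₂ * u₁
    δ̄  = conj δ
    m  = conj u₁ * w₁ + conj u₂ * w₂
    N  = norm m

    λ̄ ū₁ ū₂ w̄₁ w̄₂ : C
    λ̄ = conj λ₀
    ū₁ = conj u₁
    ū₂ = conj u₂
    w̄₁ = conj w₁
    w̄₂ = conj w₂

    δ̄≡ : δ̄ ≡ w̄₁ * ū₂ - w̄₂ * ū₁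
    δ̄≡ = trans (conj-- _ _) (cong₂ _-_ (conj-* _ _) (conj-* _ _))

    N≡ : N ≡ (ū₁ * w₁ + ū₂ * w₂) * (u₁ * w̄₁ + u₂ * w̄₂)
    N≡ = cong (m *_) (trans (conj-+ _ _) (cong₂ _+_
      (trans (conj-* _ _) (cong (_* w̄₁) (conj-conj u₁))) (trans (conj-* _ _) (cong (_* w̄₂) (conj-conj u₂)))))

    Ā₀₀ : conj (A #0 #0) ≡ λ̄ + w̄₁ * ū₂
    Ā₀₀ = trans (cong conj A₀₀) (trans (conj-+ _ _) (cong (λ̄ +_) (conj-* _ _)))
    Ā₀₁ : conj (A #0 #1) ≡ - (w̄₁ * ū₁)
    Ā₀₁ = trans (cong conj A₀₁) (trans (conj-neg _) (cong -_ (conj-* _ _)))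
    Ā₁₀ : conj (A #1 #0) ≡ w̄₂ * ū₂
    Ā₁₀ = trans (cong conj A₁₀) (conj-* _ _)
    Ā₁₁ : conj (A #1 #1) ≡ λ̄ - w̄₂ * ū₁
    Ā₁₁ = trans (cong conj A₁₁) (trans (conj-- _ _) (cong (λ t → λ̄ - t) (conj-* _ _)))

    -- Shifting t by s λ₀ + s′ λ̄ replaces A by A - λ₀, so the determinant no longer involves the
    -- eigenvalue.
    module At (s s′ τ : C) where
      p : Vec C 3
      p = point s s′ (τ - s * λ₀ - s′ * λ̄)

      t : C
      t = τ - s * λ₀ - s′ * λ̄

      K₀₀ : eval p (entry A #0 #0) ≡ τ + (s * (w₁ * u₂) + s′ * (w̄₁ * ū₂))
      K₀₀ = trans (eval-entry A s s′ t #0 #0) (trans (cong₂ (λ a b → s * a + s′ * b + t * 1#) A₀₀ Ā₀₀)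
        (solve 7 (λ s s′ τ l l̄ a ā → s :* (l :+ a) :+ s′ :* (l̄ :+ ā) :+ (τ :- s :* l :- s′ :* l̄) :* :1
            := τ :+ (s :* a :+ s′ :* ā))
          refl s s′ τ λ₀ λ̄ (w₁ * u₂) (w̄₁ * ū₂)))

      K₁₁ : eval p (entry A #1 #1) ≡ τ - (s * (w₂ * u₁) + s′ * (w̄₂ * ū₁))
      K₁₁ = trans (eval-entry A s s′ t #1 #1) (trans (cong₂ (λ a b → s * a + s′ * b + t * 1#) A₁₁ Ā₁₁)
        (solve 7 (λ s s′ τ l l̄ a ā → s :* (l :- a) :+ s′ :* (l̄ :- ā) :+ (τ :- s :* l :- s′ :* l̄) :* :1
            := τ :- (s :* a :+ s′ :* ā))
          refl s s′ τ λ₀ λ̄ (w₂ * u₁) (w̄₂ * ū₁)))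

      K₀₁ : eval p (entry A #0 #1) ≡ s′ * (w̄₂ * ū₂) - s * (w₁ * u₁)
      K₀₁ = trans (eval-entry A s s′ t #0 #1) (trans (cong₂ (λ a b → s * a + s′ * b + t * 0#) A₀₁ Ā₁₀)
        (solve 5 (λ s s′ t a ā → s :* (:- a) :+ s′ :* ā :+ t :* :0 := s′ :* ā :- s :* a) refl s s′ t
            (w₁ * u₁) (w̄₂ * ū₂)))

      K₁₀ : eval p (entry A #1 #0) ≡ s * (w₂ * u₂) - s′ * (w̄₁ * ū₁)
      K₁₀ = trans (eval-entry A s s′ t #1 #0) (trans (cong₂ (λ a b → s * a + s′ * b + t * 0#) A₁₀ Ā₀₁)
        (solve 5 (λ s s′ t a ā → s :* a :+ s′ :* (:- ā) :+ t :* :0 := s :* a :- s′ :* ā) refl s s′ t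
            (w₂ * u₂) (w̄₁ * ū₁)))

      -- With B = A - λ₀ the determinant is that of τ + sB + s′B*. Both B and B* are singular, so s²
      -- and s′² do not occur; the traces give the terms linear in τ, and the mixed term is - |m|².
      evalFA : eval p (FA A) ≡ τ * τ + τ * (s * δ + s′ * δ̄) - N * (s * s′)
      evalFA = trans (cong₂ (λ a b → a + (- b)) (cong₂ _*_ K₀₀ K₁₁) (cong₂ _*_ K₀₁ K₁₀)) (trans
        (solve 11 (λ s s′ τ u₁ u₂ w₁ w₂ v₁ v₂ x₁ x₂ →
            (τ :+ (s :* (w₁ :* u₂) :+ s′ :* (x₁ :* v₂))) :* (τ :- (s :* (w₂ :* u₁) :+ s′ :* (x₂ :* v₁)))
            :+ (:- ((s′ :* (x₂ :* v₂) :- s :* (w₁ :* u₁)) :* (s :* (w₂ :* u₂) :- s′ :* (x₁ :* v₁))))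
            := τ :* τ :+ τ :* (s :* (w₁ :* u₂ :- w₂ :* u₁) :+ s′ :* (x₁ :* v₂ :- x₂ :* v₁))
               :- ((v₁ :* w₁ :+ v₂ :* w₂) :* (u₁ :* x₁ :+ u₂ :* x₂)) :* (s :* s′))
          refl s s′ τ u₁ u₂ w₁ w₂ ū₁ ū₂ w̄₁ w̄₂)
        (cong₂ (λ d n → τ * τ + τ * (s * δ + s′ * d) - n * (s * s′)) (sym δ̄≡) (sym N≡)))

      g : Fin 3 → C
      g i = eval p (∂ i (FA A))

      gT : g T ≡ s * δ + s′ * δ̄ + two * τ
      gT = trans (polar-cong (∂T-entry A s s′ t #0 #0) (∂T-entry A s s′ t #0 #1) (∂T-entry A s s′ t #1 #0)
          (∂T-entry A s s′ t #1 #1) K₀₀ K₀₁ K₁₀ K₁₁)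
        (trans (solve 5 (λ τ a b c d → (:1 :* (τ :- b) :+ (τ :+ a) :* :1) :+ (:- (:0 :* d :+ c :* :0)) :=
            (a :- b) :+ :2 :* τ)
           refl τ (s * (w₁ * u₂) + s′ * (w̄₁ * ū₂)) (s * (w₂ * u₁) + s′ * (w̄₂ * ū₁))
               (s′ * (w̄₂ * ū₂) - s * (w₁ * u₁)) (s * (w₂ * u₂) - s′ * (w̄₁ * ū₁)))
        (trans (cong (_+ two * τ) (solve 6 (λ s s′ a b c d → (s :* a :+ s′ :* b) :- (s :* c :+ s′ :* d)
            := s :* (a :- c) :+ s′ :* (b :- d))
           refl s s′ (w₁ * u₂) (w̄₁ * ū₂) (w₂ * u₁) (w̄₂ * ū₁)))
        (cong (λ d → s * δ + s′ * d + two * τ) (sym δ̄≡))))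

      private
        k₀₀ k₀₁ k₁₀ k₁₁ : C
        k₀₀ = τ + (s * (w₁ * u₂) + s′ * (w̄₁ * ū₂))
        k₀₁ = s′ * (w̄₂ * ū₂) - s * (w₁ * u₁)
        k₁₀ = s * (w₂ * u₂) - s′ * (w̄₁ * ū₁)
        k₁₁ = τ - (s * (w₂ * u₁) + s′ * (w̄₂ * ū₁))

        polar-K : C → C → C → C → C
        polar-K a b c d = polar a b c d k₀₀ k₀₁ k₁₀ k₁₁

        gX≡ : g X ≡ polar-K (ReM A #0 #0) (ReM A #0 #1) (ReM A #1 #0) (ReM A #1 #1)
        gX≡ = polar-cong (∂X-entry A s s′ t #0 #0) (∂X-entry A s s′ t #0 #1) (∂X-entry A s s′ t #1 #0)
            (∂X-entry A s s′ t #1 #1) K₀₀ K₀₁ K₁₀ K₁₁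

        gY≡ : g Y ≡ polar-K (ImM A #0 #0) (ImM A #0 #1) (ImM A #1 #0) (ImM A #1 #1)
        gY≡ = polar-cong (∂Y-entry A s s′ t #0 #0) (∂Y-entry A s s′ t #0 #1) (∂Y-entry A s s′ t #1 #0)
            (∂Y-entry A s s′ t #1 #1) K₀₀ K₀₁ K₁₀ K₁₁

        -- Linearity combines the derivatives along H₁ and H₂ into those along A = H₁ + βH₂ and,
        -- with - β, along A* = H₁ - βH₂.
        polar-K-linear : ∀ b h₀ h₁ h₂ h₃ i₀ i₁ i₂ i₃ → polar-K h₀ h₁ h₂ h₃ + b * polar-K i₀ i₁ i₂ i₃
                         ≡ polar-K (h₀ + b * i₀) (h₁ + b * i₁) (h₂ + b * i₂) (h₃ + b * i₃)
        polar-K-linear b h₀ h₁ h₂ h₃ i₀ i₁ i₂ i₃ = solve 13 (λ b h₀ h₁ h₂ h₃ i₀ i₁ i₂ i₃ k₀ k₁ k₂ k₃ →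
             ((h₀ :* k₃ :+ k₀ :* h₃) :+ (:- (h₁ :* k₂ :+ k₁ :* h₂))) :+ b :*
                 ((i₀ :* k₃ :+ k₀ :* i₃) :+ (:- (i₁ :* k₂ :+ k₁ :* i₂)))
             := ((h₀ :+ b :* i₀) :* k₃ :+ k₀ :* (h₃ :+ b :* i₃)) :+
                 (:- ((h₁ :+ b :* i₁) :* k₂ :+ k₁ :* (h₂ :+ b :* i₂))))
           refl b h₀ h₁ h₂ h₃ i₀ i₁ i₂ i₃ k₀₀ k₀₁ k₁₀ k₁₁

        polar-A : ∀ l a₁ a₂ b₁ b₂ c₁ c₂ d₁ d₂ →
          let δ′ = b₁ * a₂ - b₂ * a₁
              δ″ = d₁ * c₂ - d₂ * c₁ in
          polar (l + b₁ * a₂) (- (b₁ * a₁)) (b₂ * a₂) (l - b₂ * a₁)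
                (τ + (s * (b₁ * a₂) + s′ * (d₁ * c₂))) (s′ * (d₂ * c₂) - s * (b₁ * a₁))
                (s * (b₂ * a₂) - s′ * (d₁ * c₁)) (τ - (s * (b₂ * a₁) + s′ * (d₂ * c₁)))
          ≡ (τ * δ′ - (c₁ * b₁ + c₂ * b₂) * (a₁ * d₁ + a₂ * d₂) * s′) + l * (s * δ′ + s′ * δ″ + two * τ)
        polar-A l a₁ a₂ b₁ b₂ c₁ c₂ d₁ d₂ = solve 12 (λ s s′ τ l a₁ a₂ b₁ b₂ c₁ c₂ d₁ d₂ →
            ((l :+ b₁ :* a₂) :* (τ :- (s :* (b₂ :* a₁) :+ s′ :* (d₂ :* c₁)))
              :+ (τ :+ (s :* (b₁ :* a₂) :+ s′ :* (d₁ :* c₂))) :* (l :- b₂ :* a₁))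
            :+ (:- ((:- (b₁ :* a₁)) :* (s :* (b₂ :* a₂) :- s′ :* (d₁ :* c₁))
              :+ (s′ :* (d₂ :* c₂) :- s :* (b₁ :* a₁)) :* (b₂ :* a₂)))
            := (τ :* (b₁ :* a₂ :- b₂ :* a₁) :- (c₁ :* b₁ :+ c₂ :* b₂) :* (a₁ :* d₁ :+ a₂ :* d₂) :* s′)
               :+ l :* (s :* (b₁ :* a₂ :- b₂ :* a₁) :+ s′ :* (d₁ :* c₂ :- d₂ :* c₁) :+ :2 :* τ))
          refl s s′ τ l a₁ a₂ b₁ b₂ c₁ c₂ d₁ d₂

        polar-Ā : ∀ l a₁ a₂ b₁ b₂ c₁ c₂ d₁ d₂ →
          let δ′ = b₁ * a₂ - b₂ * a₁
              δ″ = d₁ * c₂ - d₂ * c₁ in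
          polar (l + d₁ * c₂) (d₂ * c₂) (- (d₁ * c₁)) (l - d₂ * c₁)
                (τ + (s * (b₁ * a₂) + s′ * (d₁ * c₂))) (s′ * (d₂ * c₂) - s * (b₁ * a₁))
                (s * (b₂ * a₂) - s′ * (d₁ * c₁)) (τ - (s * (b₂ * a₁) + s′ * (d₂ * c₁)))
          ≡ (τ * δ″ - (c₁ * b₁ + c₂ * b₂) * (a₁ * d₁ + a₂ * d₂) * s) + l * (s * δ′ + s′ * δ″ + two * τ)
        polar-Ā l a₁ a₂ b₁ b₂ c₁ c₂ d₁ d₂ = solve 12 (λ s s′ τ l a₁ a₂ b₁ b₂ c₁ c₂ d₁ d₂ →
            ((l :+ d₁ :* c₂) :* (τ :- (s :* (b₂ :* a₁) :+ s′ :* (d₂ :* c₁)))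
              :+ (τ :+ (s :* (b₁ :* a₂) :+ s′ :* (d₁ :* c₂))) :* (l :- d₂ :* c₁))
            :+ (:- ((d₂ :* c₂) :* (s :* (b₂ :* a₂) :- s′ :* (d₁ :* c₁))
              :+ (s′ :* (d₂ :* c₂) :- s :* (b₁ :* a₁)) :* (:- (d₁ :* c₁))))
            := (τ :* (d₁ :* c₂ :- d₂ :* c₁) :- (c₁ :* b₁ :+ c₂ :* b₂) :* (a₁ :* d₁ :+ a₂ :* d₂) :* s)
               :+ l :* (s :* (b₁ :* a₂ :- b₂ :* a₁) :+ s′ :* (d₁ :* c₂ :- d₂ :* c₁) :+ :2 :* τ))
          refl s s′ τ l a₁ a₂ b₁ b₂ c₁ c₂ d₁ d₂

        re-im≡′ : ∀ a b → (a + b) * half + (- β) * ((a - b) * halfβ) ≡ b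
        re-im≡′ a b = trans (solve 3 (λ x b y → x :+ (:- b) :* y := x :- b :* y) refl ((a + b) * half) β
            ((a - b) * halfβ)) (re-im≡ a b)

      -- From x = s + s′ and y = β(s - s′), the left side is the derivative in s at fixed t. Since τ
      -- = t + s λ₀ + s′ λ̄, the chain rule adds λ₀ times the derivative in τ.
      ∂s : g X + β * g Y ≡ (τ * δ - N * s′) + λ₀ * g T
      ∂s = begin
        g X + β * g Y
          ≡⟨ cong₂ (λ a b → a + β * b) gX≡ gY≡ ⟩
        polar-K (ReM A #0 #0) (ReM A #0 #1) (ReM A #1 #0) (ReM A #1 #1)
          + β * polar-K (ImM A #0 #0) (ImM A #0 #1) (ImM A #1 #0) (ImM A #1 #1)
          ≡⟨ polar-K-linear β _ _ _ _ _ _ _ _ ⟩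
        polar-K (ReM A #0 #0 + β * ImM A #0 #0) (ReM A #0 #1 + β * ImM A #0 #1)
                (ReM A #1 #0 + β * ImM A #1 #0) (ReM A #1 #1 + β * ImM A #1 #1)
          ≡⟨ polar-cong (trans (re+im≡ _ _) A₀₀) (trans (re+im≡ _ _) A₀₁) (trans (re+im≡ _ _) A₁₀)
              (trans (re+im≡ _ _) A₁₁) refl refl refl refl ⟩
        polar-K (λ₀ + w₁ * u₂) (- (w₁ * u₁)) (w₂ * u₂) (λ₀ - w₂ * u₁)
          ≡⟨ polar-A λ₀ u₁ u₂ w₁ w₂ ū₁ ū₂ w̄₁ w̄₂ ⟩
        (τ * δ - (ū₁ * w₁ + ū₂ * w₂) * (u₁ * w̄₁ + u₂ * w̄₂) * s′) + λ₀ *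
            (s * δ + s′ * (w̄₁ * ū₂ - w̄₂ * ū₁) + two * τ)
          ≡⟨ cong₂ (λ n d → (τ * δ - n * s′) + λ₀ * (s * δ + s′ * d + two * τ)) N≡ δ̄≡ ⟨
        (τ * δ - N * s′) + λ₀ * (s * δ + s′ * δ̄ + two * τ)
          ≡⟨ cong (λ h → (τ * δ - N * s′) + λ₀ * h) gT ⟨
        (τ * δ - N * s′) + λ₀ * g T ∎
        where open ≡-Reasoning

      ∂s′ : g X + (- β) * g Y ≡ (τ * δ̄ - N * s) + λ̄ * g T
      ∂s′ = begin
        g X + (- β) * g Y
          ≡⟨ cong₂ (λ a b → a + (- β) * b) gX≡ gY≡ ⟩
        polar-K (ReM A #0 #0) (ReM A #0 #1) (ReM A #1 #0) (ReM A #1 #1)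
          + (- β) * polar-K (ImM A #0 #0) (ImM A #0 #1) (ImM A #1 #0) (ImM A #1 #1)
          ≡⟨ polar-K-linear (- β) _ _ _ _ _ _ _ _ ⟩
        polar-K (ReM A #0 #0 + (- β) * ImM A #0 #0) (ReM A #0 #1 + (- β) * ImM A #0 #1)
                (ReM A #1 #0 + (- β) * ImM A #1 #0) (ReM A #1 #1 + (- β) * ImM A #1 #1)
          ≡⟨ polar-cong (trans (re-im≡′ _ _) Ā₀₀) (trans (re-im≡′ _ _) Ā₁₀) (trans (re-im≡′ _ _) Ā₀₁)
              (trans (re-im≡′ _ _) Ā₁₁) refl refl refl refl ⟩
        polar-K (λ̄ + w̄₁ * ū₂) (w̄₂ * ū₂) (- (w̄₁ * ū₁)) (λ̄ - w̄₂ * ū₁)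
          ≡⟨ polar-Ā λ̄ u₁ u₂ w₁ w₂ ū₁ ū₂ w̄₁ w̄₂ ⟩
        (τ * (w̄₁ * ū₂ - w̄₂ * ū₁) - (ū₁ * w₁ + ū₂ * w₂) * (u₁ * w̄₁ + u₂ * w̄₂) * s) + λ̄ *
            (s * δ + s′ * (w̄₁ * ū₂ - w̄₂ * ū₁) + two * τ)
          ≡⟨ cong₂ (λ n d → (τ * d - n * s) + λ̄ * (s * δ + s′ * d + two * τ)) N≡ δ̄≡ ⟨
        (τ * δ̄ - N * s) + λ̄ * (s * δ + s′ * δ̄ + two * τ)
          ≡⟨ cong (λ h → (τ * δ̄ - N * s) + λ̄ * h) gT ⟨
        (τ * δ̄ - N * s) + λ̄ * g T ∎
        where open ≡-Reasoning

    open At using (evalFA; gT; ∂s; ∂s′)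

    -- The conic Q, its tangents and the dual conic.

    Q : C → C → C → C
    Q s s′ τ = τ * τ + τ * (s * δ + s′ * δ̄) - N * (s * s′)

    half-sum : ∀ {a b x y} → a + β * b ≡ x → a + (- β) * b ≡ y → two * a ≡ x + y
    half-sum {a} {b} refl refl = solve 3 (λ a b β → :2 :* a := a :+ β :* b :+ (a :+ (:- β) :* b)) refl a b β

    half-difference : ∀ {a b x y} → a + β * b ≡ x → a + (- β) * b ≡ y → two * β * b ≡ x - y
    half-difference {a} {b} refl refl = solve 3 (λ a b β → :2 :* β :* b := a :+ β :* b :-
        (a :+ (:- β) :* b)) refl a b β

    -- Nonsingularity is carried to Q by a linear change of variables, invertible because 2 and β
    -- are nonzero.
    nonsingular⇒ : NonSingular A → ∀ s s′ τ → Q s s′ τ ≡ 0# → τ * δ - N * s′ ≡ 0# → τ * δ̄ - N * s ≡ 0# →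
                   s * δ + s′ * δ̄ + two * τ ≡ 0# → s ≡ 0# × s′ ≡ 0# × τ ≡ 0#
    nonsingular⇒ ns s s′ τ Q≡0 e e′ eT = s≡0 , s′≡0 , τ≡0
      where
      gT≡0 : At.g s s′ τ T ≡ 0#
      gT≡0 = trans (gT s s′ τ) eT
      e₁ : At.g s s′ τ X + β * At.g s s′ τ Y ≡ 0#
      e₁ = trans (∂s s s′ τ) (trans (cong₂ (λ a b → a + λ₀ * b) e gT≡0)
          (solve 1 (λ l → :0 :+ l :* :0 := :0) refl λ₀))
      e₂ : At.g s s′ τ X + (- β) * At.g s s′ τ Y ≡ 0#
      e₂ = trans (∂s′ s s′ τ) (trans (cong₂ (λ a b → a + λ̄ * b) e′ gT≡0)
          (solve 1 (λ l → :0 :+ l :* :0 := :0) refl λ̄))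
      g≡0 : ∀ i → At.g s s′ τ i ≡ 0#
      g≡0 zero             = *≡0⇒ two≢0 (trans (half-sum e₁ e₂) (+-identityˡ 0#))
      g≡0 (suc zero)       = *≡0⇒ twoβ≢0 (trans (half-difference e₁ e₂) (-‿inverseʳ 0#))
      g≡0 (suc (suc zero)) = gT≡0
      p≡0 : ∀ i → lookup (At.p s s′ τ) i ≡ 0#
      p≡0 = ns (At.p s s′ τ) (trans (evalFA s s′ τ) Q≡0) g≡0
      s-s′≡0 : s - s′ ≡ 0#
      s-s′≡0 = *≡0⇒ β≢0 (p≡0 Y)
      s≡0 : s ≡ 0#
      s≡0 = *≡0⇒ two≢0 (trans (solve 2 (λ s s′ → :2 :* s := (s :+ s′) :+ (s :- s′)) refl s s′)
          (trans (cong₂ _+_ (p≡0 X) s-s′≡0) (+-identityˡ 0#)))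
      s′≡0 : s′ ≡ 0#
      s′≡0 = *≡0⇒ two≢0 (trans (solve 2 (λ s s′ → :2 :* s′ := (s :+ s′) :- (s :- s′)) refl s s′)
          (trans (cong₂ _-_ (p≡0 X) s-s′≡0) (-‿inverseʳ 0#)))
      τ≡0 : τ ≡ 0#
      τ≡0 = trans (solve 5 (λ τ s s′ l l̄ → τ := τ :- s :* l :- s′ :* l̄ :+ (s :* l :+ s′ :* l̄)) refl τ s
          s′ λ₀ λ̄)
        (trans (cong₂ _+_ (p≡0 T) (cong₂ (λ a b → a * λ₀ + b * λ̄) s≡0 s′≡0))
            (solve 2 (λ l l̄ → :0 :+ (:0 :* l :+ :0 :* l̄) := :0) refl λ₀ λ̄))

    -- The gradient of Q is c (Z , Z̄ , 1). In these coordinates the line ux + vy + t = 0 with z = u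
    -- + βv reads Zs + Z̄s′ + τ = 0 for Z = z - λ₀.
    TangentAt : C → C → C → C → C → Set
    TangentAt Z s s′ τ c = c ≢ 0# × Q s s′ τ ≡ 0# × τ * δ - N * s′ ≡ c * Z × τ * δ̄ - N * s ≡ c * conj Z
                         × s * δ + s′ * δ̄ + two * τ ≡ c

    inDual⇒tangent : ∀ {z} → InDual A z → ∃ λ s → ∃ λ s′ → ∃ λ τ → ∃ λ c → TangentAt (z - λ₀) s s′ τ c
    inDual⇒tangent {z} (u , v , u∈ , v∈ , z≡ , p , F≡0 , c , c≢0 , gX , gY , gT′) with point-surjective p
    ... | s , s′ , t , refl = s , s′ , τ , c , c≢0 , trans (sym (evalFA s s′ τ))
        (trans (cong (λ p → eval p (FA A)) p≡) F≡0) ,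
      tangency ∂s≡ (trans (sym (∂s s s′ τ)) (trans (cong₂ (λ a b → a + β * b) (at X gX) (at Y gY))
        (trans (solve 4 (λ c u β v → c :* u :+ β :* (c :* v) := c :* (u :+ β :* v)) refl c u β v)
            (cong (c *_) (sym z≡))))) ,
      tangency′ ,
      trans (sym (gT s s′ τ)) (at T gT′)
      where
      τ : C
      τ = t + s * λ₀ + s′ * λ̄
      p≡ : At.p s s′ τ ≡ point s s′ t
      p≡ = cong (point s s′) (solve 5 (λ t s s′ l l̄ → t :+ s :* l :+ s′ :* l̄ :- s :* l :- s′ :* l̄ := t)
          refl t s s′ λ₀ λ̄)
      at : ∀ i {x} → eval (point s s′ t) (∂ i (FA A)) ≡ x → At.g s s′ τ i ≡ x
      at i e = trans (cong (λ p → eval p (∂ i (FA A))) p≡) e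
      ∂s≡ : At.g s s′ τ T ≡ c
      ∂s≡ = at T gT′
      tangency : ∀ {x l h y} → h ≡ c → x + l * h ≡ c * y → x ≡ c * (y - l)
      tangency {x} {l} {h} {y} refl e = modulo₁ 1# e (solve 4
          (λ x l h y → x :+ :1 :* (h :* y) := h :* (y :- l) :+ :1 :* (x :+ l :* h)) refl x l h y)
      tangency′ : τ * δ̄ - N * s ≡ c * conj (z - λ₀)
      tangency′ = trans (tangency ∂s≡ (trans (sym (∂s′ s s′ τ))
          (trans (cong₂ (λ a b → a + (- β) * b) (at X gX) (at Y gY))
        (trans (solve 4 (λ c u β v → c :* u :+ (:- β) :* (c :* v) := c :* (u :- β :* v)) refl c u β v)
          (cong (c *_) (sym (trans (cong conj z≡) (conj-k+βl u∈ v∈))))))))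
        (cong (c *_) (sym (conj-- z λ₀)))

    tangent⇒inDual : ∀ {z s s′ τ c} → TangentAt (z - λ₀) s s′ τ c → InDual A z
    tangent⇒inDual {z} {s} {s′} {τ} {c} (c≢0 , Q≡0 , e , e′ , eT) =
      re z , im z , re∈Fq z , im∈Fq z , sym (re+βim z) , At.p s s′ τ , trans (evalFA s s′ τ) Q≡0 , c , c≢0 ,
      *-cancelˡ _ _ two≢0 (trans (half-sum e₁ e₂) (modulo₁ (- (c * (z + conj z))) (inv-r _ two≢0)
        (solve 4 (λ c z z̄ h → (c :* z :+ c :* z̄) :+ (:- (c :* (z :+ z̄))) :* :1 := :2 :*
            (c :* ((z :+ z̄) :* h)) :+ (:- (c :* (z :+ z̄))) :* (:2 :* h))
          refl c z (conj z) half))) ,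
      *-cancelˡ _ _ twoβ≢0 (trans (half-difference e₁ e₂) (modulo₁ (- (c * (z - conj z))) (inv-r _ twoβ≢0)
        (solve 5 (λ c z z̄ h b → (c :* z :- c :* z̄) :+ (:- (c :* (z :- z̄))) :* :1 := :2 :* b :*
            (c :* ((z :- z̄) :* h)) :+ (:- (c :* (z :- z̄))) :* (:2 :* b :* h))
          refl c z (conj z) halfβ β))) ,
      gT≡c
      where
      gT≡c : At.g s s′ τ T ≡ c
      gT≡c = trans (gT s s′ τ) eT
      e₁ : At.g s s′ τ X + β * At.g s s′ τ Y ≡ c * z
      e₁ = trans (∂s s s′ τ) (trans (cong₂ (λ a b → a + λ₀ * b) e gT≡c)
        (solve 3 (λ c z l → c :* (z :- l) :+ l :* c := c :* z) refl c z λ₀))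
      e₂ : At.g s s′ τ X + (- β) * At.g s s′ τ Y ≡ c * conj z
      e₂ = trans (∂s′ s s′ τ) (trans (cong₂ (λ a b → a + λ̄ * b) (trans e′ (cong (c *_) (conj-- z λ₀))) gT≡c)
        (solve 3 (λ c z l → c :* (z :- l) :+ l :* c := c :* z) refl c (conj z) λ̄))

    -- The matrix of second derivatives of Q has determinant - 2Nκ, so a singular point appears once
    -- N or κ vanishes.
    κ : C
    κ = δ * δ̄ + N

    module _ (ns : NonSingular A) where
      N≢0 : N ≢ 0#
      N≢0 N≡0 with δ ≟ 0#
      -- Here Q is τ², a double line, and every point with τ = 0 is singular.
      ... | yes δ≡0 = 0≢1 (sym (proj₁ (nonsingular⇒ ns 1# 0# 0#
          (trans (cong (λ n → 0# * 0# + 0# * (1# * δ + 0# * δ̄) - n * (1# * 0#)) N≡0)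
              (solve 2 (λ d e → :0 :* :0 :+ :0 :* (:1 :* d :+ :0 :* e) :- :0 :* (:1 :* :0) := :0) refl δ δ̄))
          (trans (cong (λ n → 0# * δ - n * 0#) N≡0) (solve 1 (λ d → :0 :* d :- :0 :* :0 := :0) refl δ))
          (trans (cong (λ n → 0# * δ̄ - n * 1#) N≡0) (solve 1 (λ d → :0 :* d :- :0 :* :1 := :0) refl δ̄))
          (trans (cong (λ d → 1# * d + 0# * δ̄ + two * 0#) δ≡0)
              (solve 1 (λ d → :1 :* :0 :+ :0 :* d :+ :2 :* :0 := :0) refl δ̄)))))
      -- Here Q splits as τ(τ + sδ + s′δ̄); the witness (δ̄ , - δ , 0) is where the two lines meet.
      ... | no δ≢0 = conj-≢0 δ≢0 (proj₁ (nonsingular⇒ ns δ̄ (- δ) 0#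
          (trans (cong (λ n → 0# * 0# + 0# * (δ̄ * δ + (- δ) * δ̄) - n * (δ̄ * (- δ))) N≡0)
              (solve 2 (λ d e → :0 :* :0 :+ :0 :* (e :* d :+ (:- d) :* e) :- :0 :* (e :* (:- d)) := :0) refl
              δ δ̄))
          (trans (cong (λ n → 0# * δ - n * (- δ)) N≡0) (solve 1 (λ d → :0 :* d :- :0 :* (:- d) := :0) refl δ))
          (trans (cong (λ n → 0# * δ̄ - n * δ̄) N≡0) (solve 1 (λ d → :0 :* d :- :0 :* d := :0) refl δ̄))
          (solve 2 (λ d e → e :* d :+ (:- d) :* e :+ :2 :* :0 := :0) refl δ δ̄)))

      -- At (δ̄ , δ , N) the first two partial derivatives vanish identically, the third is 2κ and Q
      -- is Nκ; the last coordinate is nonzero.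
      κ≢0 : κ ≢ 0#
      κ≢0 κ≡0 = N≢0 (proj₂ (proj₂ (nonsingular⇒ ns δ̄ δ N
          (modulo₁ N κ≡0 (solve 3 (λ d e n → n :* n :+ n :* (e :* d :+ d :* e) :- n :* (e :* d) :+ n :* :0
              := :0 :+ n :* (d :* e :+ n)) refl δ δ̄ N))
          (-‿inverseʳ (N * δ)) (-‿inverseʳ (N * δ̄))
          (modulo₁ two κ≡0 (solve 3 (λ d e n → e :* d :+ d :* e :+ :2 :* n :+ :2 :* :0 := :0 :+ :2 :*
              (d :* e :+ n)) refl δ δ̄ N)))))

      -- The combination of the gradient of Q with weights δ̄, δ, N eliminates s and s′ and equals
      -- 2κτ; on (Z , Z̄ , 1) it takes the value E Z.
      E : C → C
      E Z = Z * δ̄ + conj Z * δ + N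

      :4 : ∀ {n} → Polynomial n
      :4 = :2 :+ :2

      four : C
      four = two + two

      -- Where the gradient of Q is c (Z , Z̄ , 1), one has c² (E² − 4 κ |Z|²) = 4 κ N Q.
      inDual⇒disc : ∀ {z} → InDual A z → E (z - λ₀) * E (z - λ₀) ≡ four * (κ * norm (z - λ₀))
      inDual⇒disc {z} d with inDual⇒tangent d
      ... | s , s′ , τ , c , c≢0 , Q≡0 , e , e′ , eT = *-cancelˡ _ _ (*-≢0 c≢0 c≢0) (begin
        c * c * (E Z * E Z)                    ≡⟨ solve 2
            (λ c e → c :* c :* (e :* e) := (c :* e) :* (c :* e)) refl c (E Z) ⟩
        (c * E Z) * (c * E Z)                  ≡⟨ cong (λ t → t * t) cE ⟩
        (two * (τ * κ)) * (two * (τ * κ))      ≡⟨ modulo₁ (four * (κ * N)) Q≡0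
          (solve 6 (λ d d̄ N s s′ τ → let K = d :* d̄ :+ N; 4KN = :4 :* (K :* N) in
            (:2 :* (τ :* K)) :* (:2 :* (τ :* K)) :+ 4KN :* :0
            := :4 :* (K :* ((τ :* d :- N :* s′) :* (τ :* d̄ :- N :* s))) :+ 4KN :*
                (τ :* τ :+ τ :* (s :* d :+ s′ :* d̄) :- N :* (s :* s′)))
            refl δ δ̄ N s s′ τ) ⟩
        four * (κ * ((τ * δ - N * s′) * (τ * δ̄ - N * s))) ≡⟨ cong₂ (λ a b → four * (κ * (a * b))) e e′ ⟩
        four * (κ * ((c * Z) * (c * conj Z)))  ≡⟨ solve 4
            (λ c z z̄ k → :4 :* (k :* ((c :* z) :* (c :* z̄))) := c :* c :* (:4 :* (k :* (z :* z̄)))) refl c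
            Z (conj Z) κ ⟩
        c * c * (four * (κ * norm Z))          ∎)
        where
        open ≡-Reasoning
        Z : C
        Z = z - λ₀
        cE : c * E Z ≡ two * (τ * κ)
        cE = modulo₃ (- δ̄) e (- δ) e′ (- N) eT
          (solve 9 (λ c z z̄ d d̄ N s s′ τ →
            c :* (z :* d̄ :+ z̄ :* d :+ N) :+ (:- d̄) :* (c :* z) :+ (:- d) :* (c :* z̄) :+ (:- N) :* c
            := :2 :* (τ :* (d :* d̄ :+ N)) :+ (:- d̄) :* (τ :* d :- N :* s′) :+ (:- d) :*
                (τ :* d̄ :- N :* s) :+ (:- N) :* (s :* d :+ s′ :* d̄ :+ :2 :* τ))
            refl c Z (conj Z) δ δ̄ N s s′ τ)

      -- The gradient equations with c = 1 are solved for the point of contact, which is possible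
      -- since κ and N are nonzero. The discriminant condition is then what puts that point on Q.
      disc⇒inDual : ∀ {z} → E (z - λ₀) * E (z - λ₀) ≡ four * (κ * norm (z - λ₀)) → InDual A z
      disc⇒inDual {z} disc = tangent⇒inDual {z} {s} {s′} {τ} {1#}
        ((λ e → 0≢1 (sym e)) , Q≡0 , e₁ , e₂ , e₃)
        where
        Z Z̄ i τ s s′ : C
        Z  = z - λ₀
        Z̄  = conj Z
        i  = inv N
        -- Forced by 2κτ = E Z; then s and s′ are read off the first two gradient equations.
        τ  = E Z * inv (two * κ)
        s  = (τ * δ̄ - Z̄) * i
        s′ = (τ * δ - Z) * i
        2κ≢0 : two * κ ≢ 0#
        2κ≢0 = *-≢0 two≢0 κ≢0
        2τκ : two * κ * τ ≡ E Z
        2τκ = trans (solve 3 (λ k e i → k :* (e :* i) := e :* (k :* i)) refl (two * κ) (E Z) (inv (two * κ)))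
          (trans (cong (E Z *_) (inv-r _ 2κ≢0)) (trans (*-comm _ _) (*-identityˡ _)))
        Ns : N * s ≡ τ * δ̄ - Z̄
        Ns = modulo₁ (τ * δ̄ - Z̄) (inv-r _ N≢0) (solve 3
            (λ N x i → N :* (x :* i) :+ x :* :1 := x :+ x :* (N :* i)) refl N (τ * δ̄ - Z̄) i)
        Ns′ : N * s′ ≡ τ * δ - Z
        Ns′ = modulo₁ (τ * δ - Z) (inv-r _ N≢0) (solve 3
            (λ N x i → N :* (x :* i) :+ x :* :1 := x :+ x :* (N :* i)) refl N (τ * δ - Z) i)
        e₁ : τ * δ - N * s′ ≡ 1# * Z
        e₁ = trans (cong (λ t → τ * δ - t) Ns′) (solve 2 (λ a b → a :- (a :- b) := :1 :* b) refl (τ * δ) Z)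
        e₂ : τ * δ̄ - N * s ≡ 1# * Z̄
        e₂ = trans (cong (λ t → τ * δ̄ - t) Ns) (solve 2 (λ a b → a :- (a :- b) := :1 :* b) refl (τ * δ̄) Z̄)
        e₃ : s * δ + s′ * δ̄ + two * τ ≡ 1#
        e₃ = *-cancelˡ _ _ N≢0 (modulo₃ δ Ns δ̄ Ns′ 1# 2τκ
          (solve 8 (λ N s s′ d d̄ τ z z̄ →
            N :* (s :* d :+ s′ :* d̄ :+ :2 :* τ) :+ d :* (τ :* d̄ :- z̄) :+ d̄ :* (τ :* d :- z) :+ :1 :*
                (z :* d̄ :+ z̄ :* d :+ N)
            := N :* :1 :+ d :* (N :* s) :+ d̄ :* (N :* s′) :+ :1 :* (:2 :* (d :* d̄ :+ N) :* τ)) refl N s s′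
                δ δ̄ τ Z Z̄))
        4κN≢0 : four * (κ * N) ≢ 0#
        4κN≢0 = *-≢0 (λ e → *-≢0 two≢0 two≢0 (trans (solve 0 (:2 :* :2 := :4) refl) e)) (*-≢0 κ≢0 N≢0)
        Q≡0 : Q s s′ τ ≡ 0#
        Q≡0 = *≡0⇒ 4κN≢0 (begin
          four * (κ * N) * Q s s′ τ
            ≡⟨ solve 6 (λ d d̄ N s s′ τ → let K = d :* d̄ :+ N in
                 :4 :* (K :* N) :* (τ :* τ :+ τ :* (s :* d :+ s′ :* d̄) :- N :* (s :* s′))
                 := (:2 :* K :* τ) :* (:2 :* K :* τ) :- :4 :*
                     (K :* ((τ :* d :- N :* s′) :* (τ :* d̄ :- N :* s)))) refl δ δ̄ N s s′ τ ⟩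
          (two * κ * τ) * (two * κ * τ) - four * (κ * ((τ * δ - N * s′) * (τ * δ̄ - N * s)))
            ≡⟨ cong₂ (λ x y → x * x - four * (κ * y)) 2τκ (cong₂ _*_ e₁ e₂) ⟩
          E Z * E Z - four * (κ * ((1# * Z) * (1# * Z̄)))
            ≡⟨ cong₂ (λ x y → x - four * (κ * y)) disc (cong₂ _*_ (*-identityˡ Z) (*-identityˡ Z̄)) ⟩
          four * (κ * norm Z) - four * (κ * norm Z)
            ≡⟨ -‿inverseʳ _ ⟩
          0# ∎)
          where open ≡-Reasoning

  -- The fibre equations and their quadratic over F_q.

  InFq-+ : ∀ {x y} → InFq x → InFq y → InFq (x + y)
  InFq-+ x∈ y∈ = trans (conj-+ _ _) (cong₂ _+_ x∈ y∈)

  InFq-- : ∀ {x y} → InFq x → InFq y → InFq (x - y)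
  InFq-- x∈ y∈ = trans (conj-- _ _) (cong₂ _-_ x∈ y∈)

  InFq-* : ∀ {x y} → InFq x → InFq y → InFq (x * y)
  InFq-* x∈ y∈ = trans (conj-* _ _) (cong₂ _*_ x∈ y∈)

  InFq-inv : ∀ {x} → x ≢ 0# → InFq x → InFq (inv x)
  InFq-inv x≢0 x∈ = trans (conj-inv x≢0) (cong inv x∈)

  ab≡⇒āb̄≡ : ∀ {x y x′ y′} → conj x * y ≡ conj x′ * y′ → x * conj y ≡ x′ * conj y′
  ab≡⇒āb̄≡ {x} {y} {x′} {y′} e = trans (sym (conj-x̄y x y)) (trans (cong conj e) (conj-x̄y x′ y′))
    where
    conj-x̄y : ∀ x y → conj (conj x * y) ≡ x * conj y
    conj-x̄y x y = trans (conj-* _ _) (cong (_* conj y) (conj-conj x))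

  module Fibration (c m δ ζ : C) (c∈ : InFq c) (c≢0 : c ≢ 0#) (N≢0 : norm m ≢ 0#)
           (κ≢0 : δ * conj δ + norm m ≢ 0#) where

    N κ E : C
    N = norm m
    κ = δ * conj δ + N
    E = ζ * conj δ + conj ζ * δ + c * N

    m≢0 : m ≢ 0#
    m≢0 refl = N≢0 (zeroˡ _)

    Solution : C → C → Set
    Solution a b = norm a + norm b ≡ c × m * (conj a * b) + δ * norm b ≡ ζ

    -- Only an element of F_q can be |b|², so a root outside F_q carries no solution.
    Root : C → Set
    Root s = InFq s × κ * (s * s) + norm ζ ≡ E * s

    κ∈ : InFq κ
    κ∈ = InFq-+ (norm∈Fq δ) (norm∈Fq m)

    E∈ : InFq E
    E∈ = InFq-+ (trans (conj-+ _ _) (trans (cong₂ _+_ (trans (conj-* _ _) (cong (conj ζ *_) (conj-conj δ)))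
           (trans (conj-* _ _) (cong (_* conj δ) (conj-conj ζ)))) (+-comm _ _)))
         (InFq-* c∈ (norm∈Fq m))

    -- The second equation says m ā b = ζ - δs with s = |b|²; taking norms and putting |a|² = c - s
    -- gives N(c - s)s = |ζ - δs|².
    solution⇒root : ∀ {a b} → Solution a b → Root (norm b)
    solution⇒root {a} {b} (na+nb≡c , e) = norm∈Fq b ,
      modulo₃ (N * s) na+nb≡c (- (conj ζ - conj δ * s)) e (- x) ē
        (trans (solve 9 (λ d d̄ n z z̄ c s x x̄ →
            (d :* d̄ :+ n) :* (s :* s) :+ z :* z̄ :+ n :* s :* c :+ (:- (z̄ :- d̄ :* s)) :* z :+ (:- x) :* z̄
            := (z :* d̄ :+ z̄ :* d :+ c :* n) :* s :+ (x :* x̄) :+ (:- (z̄ :- d̄ :* s)) :* (x :+ d :* s) :+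
                (:- x) :* (x̄ :+ d̄ :* s)
               :+ n :* s :* s)
            refl δ (conj δ) N ζ (conj ζ) c s x x̄)
        (trans (cong (λ t → E * s + t + (- (conj ζ - conj δ * s)) * (x + δ * s) + (- x) *
            (x̄ + conj δ * s) + N * s * s) xx̄)
        (solve 6 (λ y k l n s a → y :+ n :* (a :* s) :+ k :+ l :+ n :* s :* s := y :+ n :* s :*
            (a :+ s) :+ k :+ l)
          refl (E * s) ((- (conj ζ - conj δ * s)) * (x + δ * s)) ((- x) * (x̄ + conj δ * s)) N s (norm a))))
      where
      s x x̄ : C
      s = norm b
      x = m * (conj a * b)
      x̄ = conj m * (a * conj b)
      ē : x̄ + conj δ * s ≡ conj ζ
      ē = trans (sym (trans (conj-+ _ _) (cong₂ _+_
            (trans (conj-* _ _) (cong (conj m *_) (trans (conj-* _ _) (cong (_* conj b) (conj-conj a)))))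
            (trans (conj-* _ _) (cong (conj δ *_) (norm∈Fq b)))))) (cong conj e)
      xx̄ : x * x̄ ≡ N * (norm a * s)
      xx̄ = solve 6 (λ m n a ā b b̄ → (m :* (ā :* b)) :* (n :* (a :* b̄)) := (m :* n) :*
          ((a :* ā) :* (b :* b̄)))
             refl m (conj m) a (conj a) b (conj b)

    -- For s = 0 the quadratic forces ζ = 0, and b = 0 with |a|² = c will do. Otherwise b is any
    -- element of norm s, the linear equation determines ā, and the quadratic, divided by N s,
    -- yields |a|² = c - s.
    root⇒solution : ∀ {s} → Root s → ∃₂ λ a b → Solution a b × norm b ≡ s
    root⇒solution {s} (s∈ , root) with s ≟ 0#
    ... | yes refl with norm-surjective c∈
    ...   | a , na≡c = a , 0# , (trans (cong (norm a +_) (zeroˡ _)) (trans (+-identityʳ _) na≡c) ,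
              trans (solve 4 (λ m a d z → m :* (a :* :0) :+ d :* (:0 :* z) := :0) refl m (conj a) δ
                  (conj 0#)) (sym ζ≡0)) , zeroˡ _
      where
      ζ≡0 : ζ ≡ 0#
      ζ≡0 = norm≡0⇒≡0 (modulo₁ 1# root (solve 3 (λ k n e → n :+ :1 :* (e :* :0) := :0 :+ :1 :*
          (k :* (:0 :* :0) :+ n)) refl κ (norm ζ) E))
    root⇒solution {s} (s∈ , root) | no s≢0 with norm-surjective s∈
    ... | b , nb≡s = conj ā , b , (na+nb≡c , eqn) , nb≡s
      where
      b≢0 : b ≢ 0#
      b≢0 refl = s≢0 (trans (sym nb≡s) (zeroˡ _))
      mb≢0 : m * b ≢ 0#
      mb≢0 = *-≢0 m≢0 b≢0
      i ā : C
      i = inv (m * b)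
      ā = (ζ - δ * s) * i
      mbā : (m * b) * ā ≡ ζ - δ * s
      mbā = modulo₁ (ζ - δ * s) (inv-r _ mb≢0) (solve 3
          (λ k x i → k :* (x :* i) :+ x :* :1 := x :+ x :* (k :* i)) refl (m * b) (ζ - δ * s) i)
      eqn : m * (conj (conj ā) * b) + δ * norm b ≡ ζ
      eqn = trans (cong₂ (λ x y → m * (x * b) + δ * y) (conj-conj ā) nb≡s)
        (modulo₁ 1# mbā (solve 6 (λ m ā b d s z → m :* (ā :* b) :+ d :* s :+ :1 :* (z :- d :* s)
            := z :+ :1 :* ((m :* b) :* ā)) refl m ā b δ s ζ))
      Ns·na : (N * s) * norm ā ≡ (ζ - δ * s) * (conj ζ - conj δ * s)
      Ns·na = begin
        (N * s) * norm ā                   ≡⟨ cong (λ t → (N * t) * norm ā) nb≡s ⟨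
        (N * norm b) * norm ā              ≡⟨ cong (_* norm ā) (norm-* m b) ⟨
        norm (m * b) * norm ā              ≡⟨ norm-* (m * b) ā ⟨
        norm ((m * b) * ā)                 ≡⟨ cong norm mbā ⟩
        norm (ζ - δ * s)                   ≡⟨ cong ((ζ - δ * s) *_)
            (trans (conj-- _ _) (cong (λ t → conj ζ - t) (trans (conj-* _ _) (cong (conj δ *_) s∈)))) ⟩
        (ζ - δ * s) * (conj ζ - conj δ * s) ∎
        where open ≡-Reasoning
      na+nb≡c : norm (conj ā) + norm b ≡ c
      na+nb≡c = trans (cong₂ _+_ (trans (cong (conj ā *_) (conj-conj ā)) (*-comm _ _)) nb≡s)
        (*-cancelˡ _ _ (*-≢0 N≢0 s≢0) (modulo₂ 1# Ns·na 1# root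
          (solve 8 (λ n s y d d̄ z z̄ c → (n :* s) :* (y :+ s) :+ :1 :*
              ((z :- d :* s) :* (z̄ :- d̄ :* s)) :+ :1 :* ((z :* d̄ :+ z̄ :* d :+ c :* n) :* s)
              := (n :* s) :* c :+ :1 :* ((n :* s) :* y) :+ :1 :* ((d :* d̄ :+ n) :* (s :* s) :+ z :* z̄))
            refl N s (norm ā) δ (conj δ) ζ (conj ζ) c)))

    -- As m ≠ 0, equal |b|² gives equal ā b, and also equal |a|²; these products determine (a , b)
    -- up to one scalar.
    sameRoot⇒sameOrbit : ∀ {a b a′ b′} → Solution a b → Solution a′ b′ → norm b ≡ norm b′ →
                         ∃ λ ω → norm ω ≡ 1# × a′ ≡ ω * a × b′ ≡ ω * b
    sameRoot⇒sameOrbit {a} {b} {a′} {b′} (n , e) (n′ , e′) nb≡ = ω , norm-ω , ω-a , ω-b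
      where
      g ω : C
      -- If (a′ , b′) = ω(a , b), their Hermitian product is ω c. Dividing it by c recovers ω
      -- without distinguishing which of a and b vanishes.
      g = conj a * a′ + conj b * b′
      ω = g * inv c
      āb≡ : conj a * b ≡ conj a′ * b′
      āb≡ = *-cancelˡ _ _ m≢0 (+-cancelʳ (δ * norm b) (trans e
          (trans (sym e′) (cong (λ t → m * (conj a′ * b′) + δ * t) (sym nb≡)))))
      ab̄≡ : a * conj b ≡ a′ * conj b′
      ab̄≡ = ab≡⇒āb̄≡ āb≡
      c′ : norm a′ + norm b ≡ c
      c′ = trans (cong (norm a′ +_) nb≡) n′
      cω : ∀ {x} → c * (ω * x) ≡ g * x
      cω {x} = modulo₁ (g * x) (inv-r _ c≢0) (solve 4 (λ c g i x → c :* (g :* i :* x) :+ g :* x :* :1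
          := g :* x :+ g :* x :* (c :* i)) refl c g (inv c) x)
      ω-a : a′ ≡ ω * a
      ω-a = *-cancelˡ _ _ c≢0 (trans ca′ (sym cω))
        where
        ca′ : c * a′ ≡ g * a
        ca′ = modulo₃ (- a′) n (- b′) ab̄≡ (a′) nb≡
          (solve 9 (λ a ā b b̄ x x̄ y ȳ c → c :* x :+ (:- x) :* c :+ (:- y) :* (x :* ȳ) :+ x :* (y :* ȳ)
              := (ā :* x :+ b̄ :* y) :* a :+ (:- x) :* (a :* ā :+ b :* b̄) :+ (:- y) :* (a :* b̄) :+ x :*
                  (b :* b̄))
            refl a (conj a) b (conj b) a′ (conj a′) b′ (conj b′) c)
      ω-b : b′ ≡ ω * b
      ω-b = *-cancelˡ _ _ c≢0 (trans cb′ (sym cω))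
        where
        cb′ : c * b′ ≡ g * b
        cb′ = modulo₂ (- b′) c′ (- a′) āb≡
          (solve 9 (λ a ā b b̄ x x̄ y ȳ c → c :* y :+ (:- y) :* c :+ (:- x) :* (x̄ :* y)
              := (ā :* x :+ b̄ :* y) :* b :+ (:- y) :* (x :* x̄ :+ b :* b̄) :+ (:- x) :* (ā :* b))
            refl a (conj a) b (conj b) a′ (conj a′) b′ (conj b′) c)
      norm-ω : norm ω ≡ 1#
      norm-ω = *-cancelˡ _ _ c≢0 (begin
        c * norm ω                            ≡⟨ cong (_* norm ω) n ⟨
        (norm a + norm b) * norm ω            ≡⟨ solve 3 (λ x y w → (x :+ y) :* w := w :* x :+ w :* y) refl
            (norm a) (norm b) (norm ω) ⟩
        norm ω * norm a + norm ω * norm b     ≡⟨ cong₂ _+_ (norm-* ω a) (norm-* ω b) ⟨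
        norm (ω * a) + norm (ω * b)           ≡⟨ cong₂ (λ x y → norm x + norm y) ω-a ω-b ⟨
        norm a′ + norm b′                     ≡⟨ n′ ⟩
        c                                     ≡⟨ *-identityˡ c ⟨
        1# * c                                ≡⟨ *-comm 1# c ⟩
        c * 1#                                ∎)
        where open ≡-Reasoning

    module SecondRoot {s₀ : C} (root₀ : Root s₀) where
      -- The other root by Vieta: the roots sum to E/κ, which lies in F_q.
      s₁ : C
      s₁ = E * inv κ - s₀

      κs₁ : κ * s₁ ≡ E - κ * s₀
      κs₁ = modulo₁ E (inv-r _ κ≢0) (solve 4 (λ k e i s → k :* (e :* i :- s) :+ e :* :1 :=
          (e :- k :* s) :+ e :* (k :* i)) refl κ E (inv κ) s₀)

      root₁ : Root s₁
      root₁ = InFq-- (InFq-* E∈ (InFq-inv κ≢0 κ∈)) (proj₁ root₀) ,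
        modulo₂ (s₁ - s₀) κs₁ 1# (proj₂ root₀)
          (solve 5 (λ k e n s t → k :* (t :* t) :+ n :+ (t :- s) :* (e :- k :* s) :+ :1 :* (e :* s)
                := e :* t :+ (t :- s) :* (k :* t) :+ :1 :* (k :* (s :* s) :+ n)) refl κ E (norm ζ) s₀ s₁)

      only : ∀ {s} → Root s → s ≡ s₀ ⊎ s ≡ s₁
      only {s} (_ , e) with (s - s₀) ≟ 0#
      ... | yes s≡ = inj₁ (modulo₁ 1# s≡ (solve 2 (λ s t → s :+ :1 :* :0 := t :+ :1 :* (s :- t)) refl s s₀))
      ... | no s≢  = inj₂ (modulo₁ 1# (*≡0⇒ (*-≢0 κ≢0 s≢) product≡0)
          (solve 2 (λ s t → s :+ :1 :* :0 := t :+ :1 :* (s :- t)) refl s s₁))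
        where
        product≡0 : (κ * (s - s₀)) * (s - s₁) ≡ 0#
        product≡0 = modulo₃ (s₀ - s) κs₁ 1# e (- 1#) (proj₂ root₀)
          (solve 6 (λ k e n s t u → (k :* (u :- s)) :* (u :- t) :+ (s :- u) :* (e :- k :* s) :+ :1 :*
              (e :* u) :+ (:- :1) :* (e :* s)
            := :0 :+ (s :- u) :* (k :* t) :+ :1 :* (k :* (u :* u) :+ n) :+ (:- :1) :* (k :* (s :* s) :+ n))
                refl κ E (norm ζ) s₀ s₁ s)

      disc : C
      disc = E * E - (two + two) * (κ * norm ζ)

      -- The discriminant is the square of κ times the difference of the roots, so it vanishes
      -- exactly when they coincide.
      disc≡ : (κ * (s₁ - s₀)) * (κ * (s₁ - s₀)) ≡ disc
      disc≡ = trans (cong (λ t → t * t) κ-difference)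
        (modulo₁ ((two + two) * κ) (proj₂ root₀)
          (solve 4 (λ k e n s → (e :- :2 :* k :* s) :* (e :- :2 :* k :* s) :+ (:2 :+ :2) :* k :* (e :* s)
            := e :* e :- (:2 :+ :2) :* (k :* n) :+ (:2 :+ :2) :* k :* (k :* (s :* s) :+ n)) refl κ E
                (norm ζ) s₀))
        where
        κ-difference : κ * (s₁ - s₀) ≡ E - two * κ * s₀
        κ-difference = modulo₁ 1# κs₁ (solve 4 (λ k e s t → k :* (t :- s) :+ :1 :* (e :- k :* s) :=
            (e :- :2 :* k :* s) :+ :1 :* (k :* t)) refl κ E s₀ s₁)

      disc≡0⇒s₁≡s₀ : disc ≡ 0# → s₁ ≡ s₀
      disc≡0⇒s₁≡s₀ e with (κ * (s₁ - s₀)) ≟ 0#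
      ... | yes e′ = modulo₁ 1# (*≡0⇒ κ≢0 e′) (solve 2 (λ s t → s :+ :1 :* :0 := t :+ :1 :* (s :- t)) refl
          s₁ s₀)
      ... | no ≢0 = contradiction (trans disc≡ e) (*-≢0 ≢0 ≢0)

      s₁≡s₀⇒disc≡0 : s₁ ≡ s₀ → disc ≡ 0#
      s₁≡s₀⇒disc≡0 e = trans (sym disc≡) (trans (cong (λ t → (κ * (t - s₀)) * (κ * (t - s₀))) e)
        (solve 2 (λ k s → (k :* (s :- s)) :* (k :* (s :- s)) := :0) refl κ s₀))

  -- Unitary scalars acting on the fibre.

  norm≡1⇒InU : ∀ {w} → norm w ≡ 1# → InU w
  norm≡1⇒InU {w} e = re w , im w , re∈Fq w , im∈Fq w , sym (re+βim w) , (begin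
    re w * re w - α * (im w * im w)
      ≡⟨ solve 3 (λ k l b → k :* k :- b :* b :* (l :* l) := (k :+ b :* l) :* (k :- b :* l)) refl (re w)
          (im w) β ⟩
    (re w + β * im w) * (re w - β * im w)
      ≡⟨ cong ((re w + β * im w) *_) (conj-k+βl (re∈Fq w) (im∈Fq w)) ⟨
    norm (re w + β * im w)                  ≡⟨ cong norm (re+βim w) ⟩
    norm w                                  ≡⟨ e ⟩
    1#                                      ∎)
    where open ≡-Reasoning

  InU⇒norm≡1 : ∀ {w} → InU w → norm w ≡ 1#
  InU⇒norm≡1 (k , l , k∈ , l∈ , refl , e) = trans (cong ((k + β * l) *_) (conj-k+βl k∈ l∈))
    (trans (solve 3 (λ k l b → (k :+ b :* l) :* (k :- b :* l) := k :* k :- b :* b :* (l :* l)) refl k l β) e)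

  form-scale : ∀ (ω : C) (x y a b : C) →
    conj (ω * x) * (ω * a) + (conj (ω * y) * (ω * b) + 0#) ≡ norm ω * (conj x * a + (conj y * b + 0#))
  form-scale ω x y a b = trans (cong₂ (λ s t → s * (ω * a) + (t * (ω * b) + 0#)) (conj-* ω x) (conj-* ω y))
    (solve 6 (λ w w̄ x y a b → w̄ :* x :* (w :* a) :+ (w̄ :* y :* (w :* b) :+ :0) := w :* w̄ :*
        (x :* a :+ (y :* b :+ :0)))
      refl ω (conj ω) (conj x) (conj y) a b)

  scale-norm : ∀ ω (v : Vec C 2) → ⟨ map (ω *_) v , map (ω *_) v ⟩ ≡ norm ω * ⟨ v , v ⟩
  scale-norm ω (x ∷ y ∷ []) = form-scale ω x y x y

  scale-value : ∀ (A : Mat 2) ω (v : Vec C 2) → ⟨ A · map (ω *_) v , map (ω *_) v ⟩ ≡ norm ω * ⟨ A · v , v ⟩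
  scale-value A ω (x ∷ y ∷ []) = trans
    (cong₂ (λ a b → conj (ω * x) * a + (conj (ω * y) * b + 0#)) (row (A #0 #0) (A #0 #1))
        (row (A #1 #0) (A #1 #1)))
    (form-scale ω x y (A #0 #0 * x + (A #0 #1 * y + 0#)) (A #1 #0 * x + (A #1 #1 * y + 0#)))
    where
    row : ∀ a b → a * (ω * x) + (b * (ω * y) + 0#) ≡ ω * (a * x + (b * y + 0#))
    row a b = solve 5 (λ a b w x y → a :* (w :* x) :+ (b :* (w :* y) :+ :0) := w :*
        (a :* x :+ (b :* y :+ :0))) refl a b ω x y

  scale-inS : ∀ (A : Mat 2) {z ω} (v : Vec C 2) → norm ω ≡ 1# → InS A z v → InS A z (map (ω *_) v)
  scale-inS A {z} {ω} v e (value , unit) =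
    trans (scale-value A ω v) (trans (cong₂ _*_ e value) (*-identityˡ z)) ,
    trans (scale-norm ω v) (trans (cong₂ _*_ e unit) (*-identityˡ 1#))

  scale-scale : ∀ ω ω′ (v : Vec C 2) → map (ω *_) (map (ω′ *_) v) ≡ map ((ω * ω′) *_) v
  scale-scale ω ω′ (x ∷ y ∷ []) = cong₂ (λ x y → x ∷ y ∷ []) (sym (*-assoc ω ω′ x)) (sym (*-assoc ω ω′ y))

  scale-1 : ∀ (v : Vec C 2) → map (1# *_) v ≡ v
  scale-1 (x ∷ y ∷ []) = cong₂ (λ x y → x ∷ y ∷ []) (*-identityˡ x) (*-identityˡ y)

  -- The action is free on unit vectors: ω is recovered as ⟨ωv,v⟩.
  scale-injective : ∀ {ω ω′} (v : Vec C 2) → ⟨ v , v ⟩ ≡ 1# → map (ω *_) v ≡ map (ω′ *_) v → ω ≡ ω′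
  scale-injective {ω} {ω′} (x ∷ y ∷ []) unit e = begin
    ω                                             ≡⟨ expand ω ⟩
    conj x * (ω * x) + (conj y * (ω * y) + 0#)    ≡⟨ cong₂ (λ a b → conj x * a + (conj y * b + 0#))
        (cong head e) (cong (λ w → head (tail w)) e) ⟩
    conj x * (ω′ * x) + (conj y * (ω′ * y) + 0#)  ≡⟨ expand ω′ ⟨
    ω′                                            ∎
    where
    open ≡-Reasoning
    expand : ∀ w → w ≡ conj x * (w * x) + (conj y * (w * y) + 0#)
    expand w = modulo₁ (- w) unit (solve 5 (λ w x x̄ y ȳ → w :+ (:- w) :* :1
        := x̄ :* (w :* x) :+ (ȳ :* (w :* y) :+ :0) :+ (:- w) :* (x̄ :* x :+ (ȳ :* y :+ :0))) refl w x
            (conj x) y (conj y))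

  InS-irrelevant : ∀ (A : Mat 2) z → Irrelevant (InS A z)
  InS-irrelevant A z (p , e) (p′ , e′) = cong₂ _,_ (≡-irrelevant p p′) (≡-irrelevant e e′)

  unitary-inverse : ∀ {ω} → norm ω ≡ 1# → conj ω * ω ≡ 1#
  unitary-inverse e = trans (*-comm _ _) e

  norm-conj : ∀ x → norm (conj x) ≡ norm x
  norm-conj x = trans (cong (conj x *_) (conj-conj x)) (*-comm _ _)

  -- The action being free, every orbit is a copy of the unitary group and has q + 1 elements.
  orbits⇒card : ∀ (A : Mat 2) {z m} → CardOrbits A z m → CardS A z (m ℕ.* (q ℕ.+ 1))
  orbits⇒card A {z} {m} (r , r∈ , distinct , cover) =
    mk↔ₛ′ to from to-from from-to ↔-∘ ((↔-refl ×-↔ Fin-Unitary) ↔-∘ Fin.*↔×)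
    where
    to : Fin m × Unitary → Σ (Vec C 2) (InS A z)
    to (i , (ω , e)) = map (ω *_) (lookup r i) , scale-inS A (lookup r i) e (r∈ i)

    from : Σ (Vec C 2) (InS A z) → Fin m × Unitary
    from (v , v∈) = proj₁ (cover v v∈) , proj₁ (proj₂ (cover v v∈)) , InU⇒norm≡1
        (proj₁ (proj₂ (proj₂ (cover v v∈))))

    to-from : ∀ x → to (from x) ≡ x
    to-from (v , v∈) = Σ-≡ {P = InS A z} (λ {v} → InS-irrelevant A z {v})
        (sym (proj₂ (proj₂ (proj₂ (cover v v∈)))))

    norm≡1 : ∀ {ω ω′} → norm ω ≡ 1# → norm ω′ ≡ 1# → norm (conj ω′ * ω) ≡ 1#
    norm≡1 {ω} {ω′} e e′ = trans (norm-* (conj ω′) ω) (trans (cong₂ _*_ (trans (norm-conj ω′) e′) e)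
        (*-identityˡ 1#))

    related : ∀ {ω ω′} → norm ω′ ≡ 1# → ∀ v v′ → map (ω *_) v ≡ map (ω′ *_) v′ → v′ ≡ map (conj ω′ * ω *_) v
    related {ω} {ω′} e′ v v′ same = begin
      v′                               ≡⟨ scale-1 v′ ⟨
      map (1# *_) v′                   ≡⟨ cong (λ k → map (k *_) v′) (unitary-inverse e′) ⟨
      map (conj ω′ * ω′ *_) v′         ≡⟨ scale-scale (conj ω′) ω′ v′ ⟨
      map (conj ω′ *_) (map (ω′ *_) v′) ≡⟨ cong (map (conj ω′ *_)) same ⟨
      map (conj ω′ *_) (map (ω *_) v)  ≡⟨ scale-scale (conj ω′) ω v ⟩
      map (conj ω′ * ω *_) v           ∎
      where open ≡-Reasoning

    -- If ω rᵢ = ω′ rⱼ, then rⱼ = ω̄′ω rᵢ, which contradicts the choice of inequivalent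
    -- representatives unless i = j.
    same-index : ∀ {i j ω ω′} → norm ω ≡ 1# → norm ω′ ≡ 1# → map (ω *_) (lookup r i) ≡ map (ω′ *_)
        (lookup r j) → i ≡ j
    same-index {i} {j} {ω} {ω′} e e′ same = decidable-stable (i Fin.≟ j)
      λ i≢j → distinct i j i≢j (conj ω′ * ω , norm≡1⇒InU (norm≡1 e e′) , related e′ (lookup r i)
          (lookup r j) same)

    to-injective : ∀ i j (ω ω′ : Unitary) → i ≡ j → map (proj₁ ω *_) (lookup r i) ≡ map (proj₁ ω′ *_)
        (lookup r j) → (i , ω) ≡ (j , ω′)
    to-injective i .i ω ω′ refl same = cong (i ,_) (Unitary-≡ {ω} {ω′}
        (scale-injective (lookup r i) (proj₂ (r∈ i)) same))

    from-to : ∀ x → from (to x) ≡ x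
    -- What `cover` returns is unknown, so this law is deduced from injectivity of `to` and the
    -- other inverse law.
    from-to (i , ω) = to-injective i′ i ω′ ω (same-index (proj₂ ω′) (proj₂ ω) same) same
      where
      i′ : Fin m
      i′ = proj₁ (from (to (i , ω)))
      ω′ : Unitary
      ω′ = proj₂ (from (to (i , ω)))
      same : map (proj₁ ω′ *_) (lookup r i′) ≡ map (proj₁ ω *_) (lookup r i)
      same = cong proj₁ (to-from (to (i , ω)))

  -- Coordinates along the eigenvector, and the orbits of the fibre.

  module Eigenvector (A : Mat 2) (λ₀ u₁ u₂ : C)
    (eigen : A · (u₁ ∷ u₂ ∷ []) ≡ map (λ₀ *_) (u₁ ∷ u₂ ∷ []))
    (c≢0′ : ⟨ u₁ ∷ u₂ ∷ [] , u₁ ∷ u₂ ∷ [] ⟩ ≢ 0#) where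

    ū₁ ū₂ c i w₁ w₂ : C
    ū₁ = conj u₁
    ū₂ = conj u₂
    c  = norm u₁ + norm u₂
    i  = inv c
    -- The vector w is (A - λ₀)(ū₂ , - ū₁) / c, the image of the orthogonal complement of u divided
    -- by its length c.
    w₁ = ((A #0 #0 - λ₀) * ū₂ - A #0 #1 * ū₁) * i
    w₂ = (A #1 #0 * ū₂ - (A #1 #1 - λ₀) * ū₁) * i

    c≢0 : c ≢ 0#
    c≢0 e = c≢0′ (trans (solve 4 (λ x x̄ y ȳ → x̄ :* x :+ (ȳ :* y :+ :0) := x :* x̄ :+ y :* ȳ) refl u₁ ū₁ u₂
        ū₂) e)

    -- Each row of A − λ₀ is orthogonal to u, hence proportional to (u₂ , − u₁).
    row : ∀ a b → a * u₁ + b * u₂ ≡ 0# → a ≡ (a * ū₂ - b * ū₁) * i * u₂ × b ≡ - ((a * ū₂ - b * ū₁) * i * u₁)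
    row a b e =
      modulo₂ (- a) (inv-r c c≢0) (ū₁ * i) e
        (solve 7 (λ a b x x̄ y ȳ i → a :+ (:- a) :* :1 :+ x̄ :* i :* :0
            := (a :* ȳ :- b :* x̄) :* i :* y :+ (:- a) :* ((x :* x̄ :+ y :* ȳ) :* i) :+ x̄ :* i :*
                (a :* x :+ b :* y)) refl a b u₁ ū₁ u₂ ū₂ i) ,
      modulo₂ (- b) (inv-r c c≢0) (ū₂ * i) e
        (solve 7 (λ a b x x̄ y ȳ i → b :+ (:- b) :* :1 :+ ȳ :* i :* :0
            := (:- ((a :* ȳ :- b :* x̄) :* i :* x)) :+ (:- b) :* ((x :* x̄ :+ y :* ȳ) :* i) :+ ȳ :* i :*
                (a :* x :+ b :* y)) refl a b u₁ ū₁ u₂ ū₂ i)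

    row₁ : (A #0 #0 - λ₀) * u₁ + A #0 #1 * u₂ ≡ 0#
    row₁ = modulo₁ 1# (cong head eigen) (solve 5 (λ a b l x y → (a :- l) :* x :+ b :* y :+ :1 :* (l :* x)
      := :0 :+ :1 :* (a :* x :+ (b :* y :+ :0))) refl (A #0 #0) (A #0 #1) λ₀ u₁ u₂)

    row₂ : A #1 #0 * u₁ + (A #1 #1 - λ₀) * u₂ ≡ 0#
    row₂ = modulo₁ 1# (cong (λ v → head (tail v)) eigen)
        (solve 5 (λ a b l x y → a :* x :+ (b :- l) :* y :+ :1 :* (l :* y)
      := :0 :+ :1 :* (a :* x :+ (b :* y :+ :0))) refl (A #1 #0) (A #1 #1) λ₀ u₁ u₂)

    unshift : ∀ {a x y} → a - x ≡ y → a ≡ x + y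
    unshift {a} {x} refl = solve 2 (λ a x → a := x :+ (a :- x)) refl a x

    A₀₀ : A #0 #0 ≡ λ₀ + w₁ * u₂
    A₀₀ = unshift (proj₁ (row _ _ row₁))
    A₀₁ : A #0 #1 ≡ - (w₁ * u₁)
    A₀₁ = proj₂ (row _ _ row₁)
    A₁₀ : A #1 #0 ≡ w₂ * u₂
    A₁₀ = proj₁ (row _ _ row₂)
    A₁₁ : A #1 #1 ≡ λ₀ - w₂ * u₁
    A₁₁ = unshift (proj₂ (row _ _ row₂))

    private module Curve = Rank1 A λ₀ u₁ u₂ w₁ w₂ A₀₀ A₀₁ A₁₀ A₁₁
    open Curve using (δ; m; inDual⇒disc; disc⇒inDual)

    c∈ : InFq c
    c∈ = InFq-+ (norm∈Fq u₁) (norm∈Fq u₂)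

    -- Hermitian products of v with u and with (ū₂ , - ū₁).
    coordA coordB : Vec C 2 → C
    coordA (x ∷ y ∷ []) = ū₁ * x + ū₂ * y
    coordB (x ∷ y ∷ []) = u₂ * x - u₁ * y

    -- The expansion (a u + b u′) / c in the orthogonal basis u, u′ = (ū₂ , - ū₁), both of length c.
    fromCoords : C → C → Vec C 2
    fromCoords a b = (u₁ * a + ū₂ * b) * i ∷ (u₂ * a - ū₁ * b) * i ∷ []

    coordA-fromCoords : ∀ a b → coordA (fromCoords a b) ≡ a
    coordA-fromCoords a b = modulo₁ a (inv-r c c≢0)
      (solve 7 (λ a b x x̄ y ȳ i → x̄ :* ((x :* a :+ ȳ :* b) :* i) :+ ȳ :*
          ((y :* a :- x̄ :* b) :* i) :+ a :* :1 := a :+ a :* ((x :* x̄ :+ y :* ȳ) :* i)) refl a b u₁ ū₁ u₂ ū₂ i)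

    coordB-fromCoords : ∀ a b → coordB (fromCoords a b) ≡ b
    coordB-fromCoords a b = modulo₁ b (inv-r c c≢0)
      (solve 7 (λ a b x x̄ y ȳ i → y :* ((x :* a :+ ȳ :* b) :* i) :- x :*
          ((y :* a :- x̄ :* b) :* i) :+ b :* :1 := b :+ b :* ((x :* x̄ :+ y :* ȳ) :* i)) refl a b u₁ ū₁ u₂ ū₂ i)

    fromCoords-coords : ∀ v → fromCoords (coordA v) (coordB v) ≡ v
    fromCoords-coords (x ∷ y ∷ []) = cong₂ (λ x y → x ∷ y ∷ [])
      (modulo₁ x (inv-r c c≢0) (solve 7 (λ x y a ā b b̄ i →
          (a :* (ā :* x :+ b̄ :* y) :+ b̄ :* (b :* x :- a :* y)) :* i :+ x :* :1 := x :+ x :*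
          ((a :* ā :+ b :* b̄) :* i)) refl x y u₁ ū₁ u₂ ū₂ i))
      (modulo₁ y (inv-r c c≢0) (solve 7 (λ x y a ā b b̄ i →
          (b :* (ā :* x :+ b̄ :* y) :- ā :* (b :* x :- a :* y)) :* i :+ y :* :1 := y :+ y :*
          ((a :* ā :+ b :* b̄) :* i)) refl x y u₁ ū₁ u₂ ū₂ i))

    fromCoords-scale : ∀ ω a b → fromCoords (ω * a) (ω * b) ≡ map (ω *_) (fromCoords a b)
    fromCoords-scale ω a b = cong₂ (λ x y → x ∷ y ∷ [])
      (solve 6 (λ w a b x y i → (x :* (w :* a) :+ y :* (w :* b)) :* i := w :* ((x :* a :+ y :* b) :* i))
          refl ω a b u₁ ū₂ i)
      (solve 6 (λ w a b x y i → (x :* (w :* a) :- y :* (w :* b)) :* i := w :* ((x :* a :- y :* b) :* i))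
          refl ω a b u₂ ū₁ i)

    coordB-scale : ∀ ω v → coordB (map (ω *_) v) ≡ ω * coordB v
    coordB-scale ω (x ∷ y ∷ []) = solve 5 (λ w x y a b → b :* (w :* x) :- a :* (w :* y) := w :*
        (b :* x :- a :* y)) refl ω x y u₁ u₂

    coords-~U : ∀ {v v′} → (∃ λ ω → norm ω ≡ 1# × coordA v′ ≡ ω * coordA v × coordB v′ ≡ ω * coordB v) → v ~U v′
    coords-~U {v} {v′} (ω , norm≡1 , a′≡ , b′≡) = ω , norm≡1⇒InU norm≡1 ,
      trans (sym (fromCoords-coords v′)) (trans (cong₂ fromCoords a′≡ b′≡)
        (trans (fromCoords-scale ω (coordA v) (coordB v)) (cong (map (ω *_)) (fromCoords-coords v))))

    conj-coordA : ∀ x y → conj (ū₁ * x + ū₂ * y) ≡ u₁ * conj x + u₂ * conj y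
    conj-coordA x y = trans (conj-+ _ _) (cong₂ _+_ (trans (conj-* _ _) (cong (_* conj x) (conj-conj u₁)))
        (trans (conj-* _ _) (cong (_* conj y) (conj-conj u₂))))

    conj-coordB : ∀ x y → conj (u₂ * x - u₁ * y) ≡ ū₂ * conj x - ū₁ * conj y
    conj-coordB x y = trans (conj-- _ _) (cong₂ _-_ (conj-* _ _) (conj-* _ _))

    coords-norm : ∀ v → norm (coordA v) + norm (coordB v) ≡ c * ⟨ v , v ⟩
    coords-norm (x ∷ y ∷ []) = trans
      (cong₂ (λ a b → (ū₁ * x + ū₂ * y) * a + (u₂ * x - u₁ * y) * b) (conj-coordA x y) (conj-coordB x y))
      (solve 8 (λ x x̄ y ȳ a ā b b̄ → (ā :* x :+ b̄ :* y) :* (a :* x̄ :+ b :* ȳ) :+ (b :* x :- a :* y) :*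
          (b̄ :* x̄ :- ā :* ȳ)
        := (a :* ā :+ b :* b̄) :* (x̄ :* x :+ (ȳ :* y :+ :0))) refl x (conj x) y (conj y) u₁ ū₁ u₂ ū₂)

    -- Since (A - λ₀)v = b w and w has coordinates (m , δ), the product of b w with v in these
    -- coordinates is b(ā m + b̄ δ).
    coords-value : ∀ v → m * (conj (coordA v) * coordB v) + δ * norm (coordB v) ≡ c *
        (⟨ A · v , v ⟩ - λ₀ * ⟨ v , v ⟩)
    coords-value (x ∷ y ∷ []) = begin
      m * (conj (ū₁ * x + ū₂ * y) * b) + δ * (b * conj b)
        ≡⟨ cong₂ (λ s t → m * (s * b) + δ * (b * t)) (conj-coordA x y) (conj-coordB x y) ⟩
      m * ((u₁ * conj x + u₂ * conj y) * b) + δ * (b * (ū₂ * conj x - ū₁ * conj y))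
        ≡⟨ solve 10 (λ x x̄ y ȳ a ā b b̄ w v → (ā :* w :+ b̄ :* v) :*
            ((a :* x̄ :+ b :* ȳ) :* (b :* x :- a :* y))
              :+ (w :* b :- v :* a) :* ((b :* x :- a :* y) :* (b̄ :* x̄ :- ā :* ȳ))
            := (a :* ā :+ b :* b̄) :* ((x̄ :* w :+ ȳ :* v) :* (b :* x :- a :* y)))
            refl x (conj x) y (conj y) u₁ ū₁ u₂ ū₂ w₁ w₂ ⟩
      c * ((conj x * w₁ + conj y * w₂) * b)
        ≡⟨ cong (c *_) (solve 9 (λ x x̄ y ȳ a b w v l → (x̄ :* w :+ ȳ :* v) :* (b :* x :- a :* y)
            := (x̄ :* ((l :+ w :* b) :* x :+ ((:- (w :* a)) :* y :+ :0)) :+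
                (ȳ :* (v :* b :* x :+ ((l :- v :* a) :* y :+ :0)) :+ :0))
               :- l :* (x̄ :* x :+ (ȳ :* y :+ :0))) refl x (conj x) y (conj y) u₁ u₂ w₁ w₂ λ₀) ⟩
      c * (value (λ₀ + w₁ * u₂) (- (w₁ * u₁)) (w₂ * u₂) (λ₀ - w₂ * u₁) - λ₀ * ⟨ x ∷ y ∷ [] , x ∷ y ∷ [] ⟩)
        ≡⟨ cong₂ (λ p r → c * (conj x * p + (conj y * r + 0#) - λ₀ * ⟨ x ∷ y ∷ [] , x ∷ y ∷ [] ⟩))
             (cong₂ (λ s t → s * x + (t * y + 0#)) A₀₀ A₀₁) (cong₂ (λ s t → s * x + (t * y + 0#)) A₁₀ A₁₁) ⟨
      c * (⟨ A · (x ∷ y ∷ []) , x ∷ y ∷ [] ⟩ - λ₀ * ⟨ x ∷ y ∷ [] , x ∷ y ∷ [] ⟩) ∎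
      where
      open ≡-Reasoning
      b : C
      b = u₂ * x - u₁ * y
      value : C → C → C → C → C
      value p r s t = conj x * (p * x + (r * y + 0#)) + (conj y * (s * x + (t * y + 0#)) + 0#)

    module _ (ns : NonSingular A) (z : C) where
      ζ : C
      ζ = c * (z - λ₀)

      N≢0 : norm m ≢ 0#
      N≢0 = Curve.N≢0 ns

      κ≢0 : δ * conj δ + norm m ≢ 0#
      κ≢0 = Curve.κ≢0 ns

      open Fibration c m δ ζ c∈ c≢0 N≢0 κ≢0 hiding (N; κ; E)

      inS⇒solution : ∀ v → InS A z v → Solution (coordA v) (coordB v)
      inS⇒solution v (value , unit) =
        trans (coords-norm v) (trans (cong (c *_) unit) (trans (*-comm c 1#) (*-identityˡ c))) ,
        trans (coords-value v) (trans (cong₂ (λ s t → c * (s - λ₀ * t)) value unit)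
            (solve 3 (λ c z l → c :* (z :- l :* :1) := c :* (z :- l)) refl c z λ₀))

      solution⇒inS : ∀ v → Solution (coordA v) (coordB v) → InS A z v
      solution⇒inS v (n , e) = value , unit
        where
        unit : ⟨ v , v ⟩ ≡ 1#
        unit = *-cancelˡ _ _ c≢0 (trans (sym (coords-norm v))
            (trans n (sym (trans (*-comm c 1#) (*-identityˡ c)))))
        shifted : ⟨ A · v , v ⟩ - λ₀ * ⟨ v , v ⟩ ≡ z - λ₀
        shifted = *-cancelˡ _ _ c≢0 (trans (sym (coords-value v)) e)
        value : ⟨ A · v , v ⟩ ≡ z
        value = modulo₂ 1# shifted λ₀ unit (solve 4 (λ x y l z → x :+ :1 :* (z :- l) :+ l :* :1
            := z :+ :1 :* (x :- l :* y) :+ l :* y) refl ⟨ A · v , v ⟩ ⟨ v , v ⟩ λ₀ z)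

      -- |b|² is a complete invariant of the orbits inside the fibre.
      level : Vec C 2 → C
      level v = norm (coordB v)

      ~U⇒level≡ : ∀ {v v′} → v ~U v′ → level v ≡ level v′
      ~U⇒level≡ {v} {v′} (ω , ω∈ , refl) = sym (trans (cong norm (coordB-scale ω v))
          (trans (norm-* ω (coordB v)) (trans (cong (_* level v) (InU⇒norm≡1 ω∈)) (*-identityˡ _))))

      level≡⇒~U : ∀ {v v′} → InS A z v → InS A z v′ → level v ≡ level v′ → v ~U v′
      level≡⇒~U {v} {v′} v∈ v′∈ e = coords-~U
        (sameRoot⇒sameOrbit {coordA v} {coordB v} {coordA v′} {coordB v′}
          (inS⇒solution v v∈) (inS⇒solution v′ v′∈) e)

      Solution-resp : ∀ {a a′ b b′} → a′ ≡ a → b′ ≡ b → Solution a b → Solution a′ b′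
      Solution-resp refl refl sol = sol

      coords-inS : ∀ {s} → (∃₂ λ a b → Solution a b × norm b ≡ s) → ∃ λ v → InS A z v × level v ≡ s
      coords-inS (a , b , sol , e) = fromCoords a b ,
        solution⇒inS (fromCoords a b) (Solution-resp (coordA-fromCoords a b) (coordB-fromCoords a b) sol) ,
        trans (cong norm (coordB-fromCoords a b)) e

      root⇒inS : ∀ {s} → Root s → ∃ λ v → InS A z v × level v ≡ s
      root⇒inS {s} r = coords-inS (root⇒solution {s} r)

      inS⇒root : ∀ v → InS A z v → Root (level v)
      inS⇒root v v∈ = solution⇒root {coordA v} {coordB v} (inS⇒solution v v∈)

      -- Membership of z in W(A) supplies v₀, whose level is the first root; the second is computed
      -- from it.
      module _ (v₀ : Vec C 2) (v₀∈ : InS A z v₀) where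
        open SecondRoot {level v₀} (inS⇒root v₀ v₀∈)

        E₁ κ₁ : C
        E₁ = Curve.E ns (z - λ₀)
        κ₁ = δ * conj δ + norm m

        conj-ζ : conj ζ ≡ c * conj (z - λ₀)
        conj-ζ = trans (conj-* _ _) (cong (_* conj (z - λ₀)) c∈)

        -- As ζ = c(z - λ₀) with c in F_q, the linear coefficient is c E and |ζ|² is c² |z - λ₀|².
        -- So the discriminant is c² times the equation of the dual conic.
        disc-scale : disc ≡ c * c * (E₁ * E₁ - (two + two) * (κ₁ * norm (z - λ₀)))
        disc-scale = trans (cong (λ t → (ζ * conj δ + t * δ + c * norm m) *
            (ζ * conj δ + t * δ + c * norm m) - (two + two) * (κ₁ * (ζ * t))) conj-ζ)
          (solve 7 (λ c z z̄ d d̄ n k → (c :* z :* d̄ :+ c :* z̄ :* d :+ c :* n) :*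
              (c :* z :* d̄ :+ c :* z̄ :* d :+ c :* n) :- (:2 :+ :2) :* (k :* (c :* z :* (c :* z̄)))
             := c :* c :* ((z :* d̄ :+ z̄ :* d :+ n) :* (z :* d̄ :+ z̄ :* d :+ n) :- (:2 :+ :2) :*
                 (k :* (z :* z̄))))
            refl c (z - λ₀) (conj (z - λ₀)) δ (conj δ) (norm m) κ₁)

        inDual⇒double : InDual A z → s₁ ≡ level v₀
        inDual⇒double d = disc≡0⇒s₁≡s₀ (trans disc-scale
            (trans (cong (λ t → c * c * (t - (two + two) * (κ₁ * norm (z - λ₀))))
            (inDual⇒disc ns d)) (solve 2 (λ c x → c :* c :* (x :- x) := :0) refl c
                ((two + two) * (κ₁ * norm (z - λ₀))))))

        double⇒inDual : s₁ ≡ level v₀ → InDual A z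
        double⇒inDual e = disc⇒inDual ns (modulo₁ 1# (*≡0⇒ (*-≢0 c≢0 c≢0)
            (trans (sym disc-scale) (s₁≡s₀⇒disc≡0 e)))
          (solve 2 (λ x y → x :+ :1 :* :0 := y :+ :1 :* (x :- y)) refl (E₁ * E₁)
              ((two + two) * (κ₁ * norm (z - λ₀)))))

        classify : ∀ v → InS A z v → level v ≡ level v₀ ⊎ level v ≡ s₁
        classify v v∈ = only {level v} (inS⇒root v v∈)

        one-orbit : InDual A z → CardOrbits A z 1
        one-orbit d = v₀ ∷ [] , (λ { zero → v₀∈ }) , (λ { zero zero 0≢0 → contradiction refl 0≢0 }) ,
          λ v v∈ → zero , level≡⇒~U {v₀} {v} v₀∈ v∈ (sym
              ([ (λ e → e) , (λ e → trans e (inDual⇒double d)) ]′ (classify v v∈)))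

        two-orbits : ¬ InDual A z → CardOrbits A z 2
        two-orbits ¬d = r , inS , distinct , λ v v∈ → cover v v∈ (classify v v∈)
          where
          second : ∃ λ v → InS A z v × level v ≡ s₁
          second = root⇒inS {s₁} root₁
          v₁ : Vec C 2
          v₁ = proj₁ second
          v₁∈ : InS A z v₁
          v₁∈ = proj₁ (proj₂ second)
          e₁ : level v₁ ≡ s₁
          e₁ = proj₂ (proj₂ second)
          r : Vec (Vec C 2) 2
          r = v₀ ∷ v₁ ∷ []
          levels≢ : level v₁ ≢ level v₀
          -- Equal levels would be a double root, which puts z on the dual curve.
          levels≢ e = ¬d (double⇒inDual (trans (sym e₁) e))
          inS : ∀ i → InS A z (lookup r i)
          inS zero       = v₀∈
          inS (suc zero) = v₁∈
          distinct : ∀ i j → ¬ (i ≡ j) → ¬ (lookup r i ~U lookup r j)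
          distinct zero       zero       i≢j _ = i≢j refl
          distinct zero       (suc zero) _   o = levels≢ (sym (~U⇒level≡ {v₀} {v₁} o))
          distinct (suc zero) zero       _   o = levels≢ (~U⇒level≡ {v₁} {v₀} o)
          distinct (suc zero) (suc zero) i≢j _ = i≢j refl
          cover : ∀ v → InS A z v → level v ≡ level v₀ ⊎ level v ≡ s₁ → Σ (Fin 2) λ i → lookup r i ~U v
          cover v v∈ (inj₁ e) = zero , level≡⇒~U {v₀} {v} v₀∈ v∈ (sym e)
          cover v v∈ (inj₂ e) = suc zero , level≡⇒~U {v₁} {v} v₁∈ v∈ (trans e₁ (sym e))

open import Data.Nat using (_+_; _*_)

theorem1p4 : (q : ℕ) → OddPrimePower q →
    (L : Field) → Fin (q * q) ↔ Field.Carrier L →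
    (β : Field.Carrier L) →
    Setup.InFq L q β (Setup.α L q β) →
    ¬ (Σ (Field.Carrier L) λ y → Setup.InFq L q β y × Field._*_ L y y ≡ Setup.α L q β) →
    (A : Setup.Mat L q β 2) →
    Setup.NonSingular L q β A →
    Setup.GoodEigen L q β A →
    (z : Field.Carrier L) → Setup.W L q β A z →
    (Setup.InDual L q β A z →
    Setup.CardOrbits L q β A z 1 × Setup.CardS L q β A z (q + 1)) ×
    (¬ Setup.InDual L q β A z →
    Setup.CardOrbits L q β A z 2 × Setup.CardS L q β A z (2 * q + 2))
theorem1p4 q q-odd L enum β α∈Fq α-nonsquare A ns (λ₀ , u₁ ∷ u₂ ∷ [] , _ , eigen , uu≢0) z (v₀ , unit , value) =
  (λ d → one d , subst (CardS A z) (ℕ.*-identityˡ (q + 1)) (orbits⇒card A (one d))) ,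
  (λ ¬d → two′ ¬d , subst (CardS A z) (ℕ.*-distribˡ-+ 2 q 1) (orbits⇒card A (two′ ¬d)))
  where
  open NumericalRange q q-odd L enum β α∈Fq α-nonsquare using (orbits⇒card; module Eigenvector)
  open Setup L q β using (CardS; CardOrbits; InDual)
  one : InDual A z → CardOrbits A z 1
  one = Eigenvector.one-orbit A λ₀ u₁ u₂ eigen uu≢0 ns z v₀ (value , unit)
  two′ : ¬ InDual A z → CardOrbits A z 2
  two′ = Eigenvector.two-orbits A λ₀ u₁ u₂ eigen uu≢0 ns z v₀ (value , unit)
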